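{- For all integers $k,l,m$ with $2\le k<l$ and $m\ge k+l-1$, $r(k,l,m)=k+l+m-2$.
   Context: For a graph whose edges are coloured with red, blue and green, a red (resp. blue, green) $t$-connected matching is a connected component of the spanning subgraph formed by the red (resp. blue, green) edges whose maximum matching has size at least $t$. For positive integers $k,l,m$, $r(k,l,m)$ denotes the smallest integer $n$ such that every red-blue-green colouring of the edges of $K_{n,n}$ contains a red $k$-connected matching, or a blue $l$-connected matching, or a green $m$-connected matching. -}

module Defs where

open import Data.Nat using (ℕ; _<_)
open import Data.Fin using (Fin)
open import Data.Sum using (_⊎_; inj₁; inj₂)
open import Data.Product using (Σ; _×_)
open import Function.Definitions using (Injective)
open import Relation.Binary.PropositionalEquality using (_≡_)
open import Relation.Binary.Construct.Closure.ReflexiveTransitive using (Star)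
open import Relation.Nullary using (¬_)

data Colour : Set where
  red blue green : Colour

-- An edge colouring of K_{n,n}: left part Fin n, right part Fin n,
-- the edge between left vertex i and right vertex j gets colour col i j.
Colouring : ℕ → Set
Colouring n = Fin n → Fin n → Colour

Vertex : ℕ → Set
Vertex n = Fin n ⊎ Fin n

data Adj {n : ℕ} (col : Colouring n) (c : Colour) : Vertex n → Vertex n → Set where
  lr : ∀ {i j} → col i j ≡ c → Adj col c (inj₁ i) (inj₂ j)
  rl : ∀ {i j} → col i j ≡ c → Adj col c (inj₂ j) (inj₁ i)

Connected : ∀ {n} → Colouring n → Colour → Vertex n → Vertex n → Set
Connected col c = Star (Adj col c)

-- A colour-c t-connected matching: a connected component of the colour-c
-- spanning subgraph (the component of the vertex v) containing a matching of
-- size t, i.e. t edges of colour c (left ends f a, right ends g a, pairwise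
-- disjoint) all lying in that component.  (A component has maximum matching
-- of size ≥ t iff it contains a matching of size exactly t.)
ConnectedMatching : ∀ {n} → Colouring n → Colour → ℕ → Set
ConnectedMatching {n} col c t =
  Σ (Vertex n) λ v →
  Σ (Fin t → Fin n) λ f →
  Σ (Fin t → Fin n) λ g →
    Injective _≡_ _≡_ f × Injective _≡_ _≡_ g
    × (∀ a → col (f a) (g a) ≡ c)
    × (∀ a → Connected col c v (inj₁ (f a)))

Arrows : ℕ → ℕ → ℕ → ℕ → Set
Arrows n k l m = (col : Colouring n) →
  ConnectedMatching col red k ⊎ ConnectedMatching col blue l ⊎ ConnectedMatching col green m

RIs : ℕ → ℕ → ℕ → ℕ → Set
RIs k l m N = Arrows N k l m × (∀ n → n < N → ¬ Arrows n k l m)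

{-# OPTIONS --safe #-}

-- Write κ = k − 1, λ′ = l − 1, μ = m − 1, t = κ + λ′ and N = t + μ + 1, so that N ≥ 2t + 1.
--
-- For the lower bound, colour each edge by its left end, with κ, λ′ and μ left vertices per colour.
--
-- For the upper bound, suppose that no required matching exists.  By König's theorem each
-- monochromatic component has a vertex cover of size at most κ, λ′ or μ.  Call the union of the covers
-- of the red and the blue component of a vertex y its shadow; it has at most t elements.  In a
-- red-blue graph a vertex of degree greater than t lies in its own shadow, since otherwise all its
-- neighbours would.  Hence a red-blue graph is impossible as soon as it has more than s t such
-- vertices that are covered by s shadows.  Bounding the number of shadows needed rests on a
-- description of red-blue complete bipartite graphs: one colour is connected, or one side lies in a
-- single red and a single blue component, or each side meets two red and two blue components.  This
-- excludes K_{t+1,t+1}, and blow-ups of a path on six vertices (three shadows) and of a hexagon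
-- (four shadows) with large enough parts.
--
-- Excluding K_{t+1,t+1} between different green components, either some green component misses at
-- most t vertices on each side, or the green components can be grouped into three blocks with at
-- most t vertices on each side.  In the first case the non-green edges outside the cover of that
-- component contain the blown-up path; in the second the edges between blocks form a blown-up hexagon.
module Submission where

open import Defs
open import Data.Bool using (Bool; true; false)
import Data.Bool.Properties as Bool
open import Data.Nat using (ℕ; zero; suc; _+_; _*_; _∸_; _≤_; _<_; z≤n; s≤s; _≤?_; _<?_; _≟_)
open import Data.Nat.Properties
open import Data.Nat.Solver using (module +-*-Solver)
open import Data.Fin using (Fin; zero; suc; toℕ; fromℕ<; inject≤)
import Data.Fin.Properties as Fin
open import Data.Fin.Properties using (toℕ<n; toℕ-injective; inject≤-injective)
open import Data.List using (List; []; _∷_; length; filter; map; _++_; lookup; allFin; cartesianProduct)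
open import Data.List.Properties using (filter-notAll; filter-all; filter-++; length-++; length-tabulate; length-map)
import Data.List.Relation.Unary.All as All
import Data.List.Relation.Unary.Any as Any
open import Data.List.Relation.Unary.Any using (Any; here; there)
open import Data.List.Relation.Unary.AllPairs using (_∷_)
open import Data.List.Relation.Unary.Unique.Propositional using (Unique)
open import Data.List.Relation.Unary.Unique.Propositional.Properties using (filter⁺; map⁺; ++⁺; allFin⁺)
open import Data.List.Membership.Propositional using () renaming (_∈_ to _∈ˡ_; find to findˡ; lose to loseˡ)
open import Data.List.Membership.Propositional.Properties using (∈-map⁺; ∈-map⁻; ∈-filter⁺; ∈-filter⁻; ∈-++⁺ˡ; ∈-++⁺ʳ; ∈-allFin; ∈-lookup; ∈-cartesianProduct⁺)
open import Data.Product using (∃; ∃₂; _×_; _,_; proj₁; proj₂)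
open import Data.Sum using (_⊎_; inj₁; inj₂; [_,_]′)
import Data.Sum as Sum
open import Data.Sum.Properties using (inj₁-injective; inj₂-injective)
open import Data.Empty using (⊥; ⊥-elim)
open import Relation.Nullary using (¬_; Dec; yes; no; ¬?; _×-dec_; _⊎-dec_; _→-dec_)
open import Relation.Nullary.Decidable using (map′; from-yes)
open import Relation.Binary.Definitions using (tri<; tri≈; tri>)
open import Relation.Binary.Construct.Closure.ReflexiveTransitive using (Star; ε; _◅_; _◅◅_)
open import Relation.Binary.PropositionalEquality using (_≡_; _≢_; refl; sym; trans; cong; subst; module ≡-Reasoning)
open import Function using (_∘_; id; case_of_)
open import Function.Definitions using (Injective)

-- Decidable vertex sets and their sizes

record Region (V : Set) : Set₁ where
  field
    Mem  : V → Set
    mem? : ∀ v → Dec (Mem v)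

open Region public

infix 4 _∈_ _∉_
infixr 6 _∪_

_∈_ _∉_ : {V : Set} → V → Region V → Set
v ∈ D = Mem D v
v ∉ D = ¬ (v ∈ D)

_∪_ : {V : Set} → Region V → Region V → Region V
(D ∪ D′) .Mem v = v ∈ D ⊎ v ∈ D′
(D ∪ D′) .mem? v = mem? D v ⊎-dec mem? D′ v

module _ {V : Set} where

  count : Region V → List V → ℕ
  count D vs = length (filter (mem? D) vs)

  count-cover : ∀ {D D₁ D₂ : Region V} → (∀ {v} → v ∈ D → v ∈ D₁ ⊎ v ∈ D₂) →
                ∀ vs → count D vs ≤ count D₁ vs + count D₂ vs
  count-cover cov [] = z≤n
  count-cover {D} {D₁} {D₂} cov (x ∷ vs) with ih ← count-cover {D} {D₁} {D₂} cov vs | mem? D x | mem? D₁ x | mem? D₂ x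
  ... | no _  | no _  | no _  = ih
  ... | no _  | no _  | yes _ = ≤-trans ih (+-monoʳ-≤ (count D₁ vs) (n≤1+n _))
  ... | no _  | yes _ | no _  = m≤n⇒m≤1+n ih
  ... | no _  | yes _ | yes _ = m≤n⇒m≤1+n (≤-trans ih (+-monoʳ-≤ (count D₁ vs) (n≤1+n _)))
  ... | yes _ | yes _ | no _  = s≤s ih
  ... | yes _ | yes _ | yes _ = s≤s (≤-trans ih (+-monoʳ-≤ (count D₁ vs) (n≤1+n _)))
  ... | yes _ | no _  | yes _ = ≤-trans (s≤s ih) (≤-reflexive (sym (+-suc (count D₁ vs) _)))
  ... | yes p | no p₁ | no p₂ = ⊥-elim ([ p₁ , p₂ ]′ (cov p))

  count-disjoint : ∀ {D₁ D₂ : Region V} → (∀ {v} → v ∈ D₁ → v ∉ D₂) →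
                   ∀ vs → count D₁ vs + count D₂ vs ≤ count (D₁ ∪ D₂) vs
  count-disjoint dis [] = z≤n
  count-disjoint {D₁} {D₂} dis (x ∷ vs) with ih ← count-disjoint {D₁} {D₂} dis vs | mem? D₁ x | mem? D₂ x
  ... | no _  | no _  = ih
  ... | yes _ | no _  = s≤s ih
  ... | no _  | yes _ = ≤-trans (≤-reflexive (+-suc (count D₁ vs) _)) (s≤s ih)
  ... | yes p | yes q = ⊥-elim (dis p q)

  count-mono : ∀ {D D′ : Region V} → (∀ {v} → v ∈ D → v ∈ D′) → ∀ vs → count D vs ≤ count D′ vs
  count-mono sub [] = z≤n
  count-mono {D} {D′} sub (x ∷ vs) with ih ← count-mono {D} {D′} sub vs | mem? D x | mem? D′ x
  ... | no _  | no _  = ih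
  ... | no _  | yes _ = m≤n⇒m≤1+n ih
  ... | yes _ | yes _ = s≤s ih
  ... | yes p | no q  = ⊥-elim (q (sub p))

  count-escape : ∀ {D D′ : Region V} vs → count D′ vs < count D vs → ∃ λ v → v ∈ D × v ∉ D′
  count-escape {D} {D′} (x ∷ vs) lt with mem? D x | mem? D′ x
  ... | yes p | no q  = x , p , q
  ... | yes _ | yes _ = count-escape {D} {D′} vs (≤-pred lt)
  ... | no _  | no _  = count-escape {D} {D′} vs lt
  ... | no _  | yes _ = count-escape {D} {D′} vs (<-trans (n<1+n _) lt)

anyBool? : ∀ {P : Bool → Set} → (∀ c → Dec (P c)) → Dec (∃ P)
anyBool? {P} P? = map′ [ true ,_ , false ,_ ]′ split (P? true ⊎-dec P? false)
  where
  split : ∃ P → P true ⊎ P false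
  split (true , p) = inj₁ p
  split (false , p) = inj₂ p

either : ∀ {c d : Bool} → c ≢ d → ∀ e → e ≡ c ⊎ e ≡ d
either {true}  {true}  c≢d _     = ⊥-elim (c≢d refl)
either {false} {false} c≢d _     = ⊥-elim (c≢d refl)
either {true}  {false} _   true  = inj₁ refl
either {true}  {false} _   false = inj₂ refl
either {false} {true}  _   true  = inj₂ refl
either {false} {true}  _   false = inj₁ refl

-- Two colours

-- label c names the component of a vertex in colour c, and S c is a vertex cover of the edges of colour c.
module TwoColours {V : Set} (label : Bool → V → ℕ) (S : Bool → Region V) where

  Edge : V → V → Set
  Edge u v = ∃ λ c → label c u ≡ label c v × (u ∈ S c ⊎ v ∈ S c)

  Agree : V → V → Set
  Agree u v = ∃ λ c → label c u ≡ label c v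

  Opposite : V → V → Set
  Opposite u v = ¬ Agree u v

  SameType : V → V → Set
  SameType u v = ∀ c → label c u ≡ label c v

  -- u lies in the vertex cover of a component of y.
  infix 4 _◁_
  _◁_ : V → V → Set
  u ◁ y = ∃ λ c → label c u ≡ label c y × u ∈ S c

  _◁?_ : ∀ u y → Dec (u ◁ y)
  u ◁? y = anyBool? λ c → (label c u ≟ label c y) ×-dec mem? (S c) u

  agree? : ∀ u v → Dec (Agree u v)
  agree? u v = anyBool? λ c → label c u ≟ label c v

  shadow : V → Region V
  shadow y .Mem u = u ◁ y
  shadow y .mem? u = u ◁? y

  Complete : Region V → Region V → Set
  Complete D D′ = ∀ {u v} → u ∈ D → v ∈ D′ → Edge u v

  edge-sym : ∀ {u v} → Edge u v → Edge v u
  edge-sym (c , eq , s) = c , sym eq , Sum.swap s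

  edge⇒agree : ∀ {u v} → Edge u v → Agree u v
  edge⇒agree (c , eq , _) = c , eq

  agree-sym : ∀ {u v} → Agree u v → Agree v u
  agree-sym (c , eq) = c , sym eq

  ◁-resp : ∀ {u y y′} → SameType y y′ → u ◁ y → u ◁ y′
  ◁-resp same (c , eq , s) = c , trans eq (same c) , s

  -- If both agreements had the same colour, `u` and `v` would agree in it through `x`.
  mixes : ∀ {u v x} → Opposite u v → (p : Agree x u) (q : Agree x v) → proj₁ p ≢ proj₁ q
  mixes opp (c , p) (.c , q) refl = opp (c , trans (sym p) q)

  ◁-mix : ∀ {u v x} → Opposite u v → Agree x u → Agree x v → x ◁ x → x ◁ u ⊎ x ◁ v
  ◁-mix opp (c , p) (d , q) (e , _ , s)
    with either (mixes opp (c , p) (d , q)) e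
  ... | inj₁ refl = inj₁ (c , p , s)
  ... | inj₂ refl = inj₂ (d , q , s)

  -- By `mixes`, one of the two components of `x` is a component of `u` and the other one of `v`, so
  -- the shadow of `x` lies in the union of theirs.
  ◁-split : ∀ {u v x y} → Opposite u v → Agree x u → Agree x v → y ◁ x → y ◁ u ⊎ y ◁ v
  ◁-split opp (c , p) (d , q) (e , eq , s)
    with either (mixes opp (c , p) (d , q)) e
  ... | inj₁ refl = inj₁ (c , trans eq p , s)
  ... | inj₂ refl = inj₂ (d , trans eq q , s)

  -- Only two types can agree with both `u` and `v`: red as `u` and blue as `v`, or the reverse.
  -- These two differ in both colours.
  same-or-opposite : ∀ {u v x y} → Opposite u v → Agree x u → Agree x v → Agree y u → Agree y v →
                     SameType x y ⊎ Opposite x y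
  same-or-opposite {u} {v} {x} {y} opp (c , p) (d , q) (c′ , p′) (d′ , q′) = go (c′ Bool.≟ c)
    where
    c≢d : c ≢ d
    c≢d = mixes opp (c , p) (d , q)
    c′≢d′ : c′ ≢ d′
    c′≢d′ = mixes opp (c′ , p′) (d′ , q′)
    go : Dec (c′ ≡ c) → SameType x y ⊎ Opposite x y
    go (yes refl) with either c≢d d′
    ... | inj₁ refl = ⊥-elim (c′≢d′ refl)
    ... | inj₂ refl = inj₁ λ e → case either c≢d e of λ where
      (inj₁ refl) → trans p (sym p′)
      (inj₂ refl) → trans q (sym q′)
    go (no c′≢c) with either c≢d c′ | either c≢d d′
    ... | inj₁ refl | _         = ⊥-elim (c′≢c refl)
    ... | inj₂ refl | inj₂ refl = ⊥-elim (c′≢d′ refl)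
    ... | inj₂ refl | inj₁ refl = inj₂ λ (e , eq) → case either c≢d e of λ where
      (inj₁ refl) → opp (c , trans (sym p) (trans eq q′))
      (inj₂ refl) → opp (d , trans (sym p′) (trans (sym eq) q))

  -- If the edge has the colour of the agreement, it lies in a component of `y`, and since `y′`
  -- avoids the shadow of `y`, the edge is covered by `a`. Otherwise the two components of `a` are
  -- one of `y` and one of `y′`.
  ◁-transfer : ∀ {a y y′} → Agree a y → Edge a y′ → ¬ y′ ◁ y → a ◁ a → a ◁ y ⊎ a ◁ y′
  ◁-transfer {a} {y} {y′} (c , p) (d , q , s) y′⋪y (e , _ , s′) = go (d Bool.≟ c)
    where
    go : Dec (d ≡ c) → a ◁ y ⊎ a ◁ y′
    go (yes refl) = [ (λ sa → inj₁ (c , p , sa)) , (λ sy → ⊥-elim (y′⋪y (c , trans (sym q) p , sy))) ]′ s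
    go (no d≢c) with either d≢c e
    ... | inj₁ refl = inj₂ (d , q , s′)
    ... | inj₂ refl = inj₁ (c , p , s′)

  module Bounded (vs : List V) (everything : ∀ v → v ∈ˡ vs) (t : ℕ)
                 (shadow≤t : ∀ y → count (shadow y) vs ≤ t) where

    ∣_∣ : Region V → ℕ
    ∣ D ∣ = count D vs

    exists? : ∀ (D : Region V) {P : V → Set} → (∀ v → Dec (P v)) → Dec (∃ λ v → v ∈ D × P v)
    exists? D P? = map′ Any.satisfied (λ (v , q) → loseˡ (everything v) q)
                        (Any.any? (λ v → mem? D v ×-dec P? v) vs)

    none⇒all : ∀ (D : Region V) {P : V → Set} → (∀ v → Dec (P v)) →
               ¬ (∃ λ v → v ∈ D × ¬ P v) → ∀ {v} → v ∈ D → P v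
    none⇒all D P? none {v} v∈D with P? v
    ... | yes p = p
    ... | no ¬p = ⊥-elim (none (v , v∈D , ¬p))

    outside : ∀ {D} y → t < ∣ D ∣ → ∃ λ v → v ∈ D × ¬ v ◁ y
    outside {D} y big = count-escape {D = D} {shadow y} vs (≤-<-trans (shadow≤t y) big)

    -- If `v` were in neither cover, all its neighbours would have to cover their edges to `v`,
    -- putting more than `t` vertices into its shadow.
    core : ∀ {D v} → t < ∣ D ∣ → (∀ {w} → w ∈ D → Edge v w) → v ◁ v
    core {D} {v} big edges with v ◁? v
    ... | yes p = p
    ... | no v⋪v with w , w∈D , w⋪v ← outside {D} v big | edges w∈D
    ...   | c , eq , inj₁ sv = ⊥-elim (v⋪v (c , refl , sv))
    ...   | c , eq , inj₂ sw = ⊥-elim (w⋪v (c , sym eq , sw))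

    shadows : List V → Region V
    shadows ys .Mem v = Any (v ◁_) ys
    shadows ys .mem? v = Any.any? (v ◁?_) ys

    shadows-size : ∀ ys → ∣ shadows ys ∣ ≤ length ys * t
    shadows-size [] = count-empty vs
      where
      count-empty : ∀ us → count (shadows []) us ≤ 0
      count-empty [] = z≤n
      count-empty (u ∷ us) with mem? (shadows []) u
      ... | no _ = count-empty us
    shadows-size (y ∷ ys) =
      ≤-trans (count-cover {D = shadows (y ∷ ys)} {shadow y} {shadows ys} Any.toSum vs)
              (+-mono-≤ (shadow≤t y) (shadows-size ys))

    cover-size : ∀ {D} ys → (∀ {v} → v ∈ D → v ∈ shadows ys) → ∣ D ∣ ≤ length ys * t
    cover-size {D} ys sub = ≤-trans (count-mono {D = D} {shadows ys} sub vs) (shadows-size ys)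

    inhabited : ∀ D → t < ∣ D ∣ → ∃ λ v → v ∈ D
    inhabited D big
      with v , v∈D , _ ← count-escape {D = D} {shadows []} vs (≤-<-trans (shadows-size []) (≤-<-trans z≤n big))
      = v , v∈D

    cover⇒small : ∀ {D} y → t < ∣ D ∣ → (∀ {v} → v ∈ D → v ◁ y) → ⊥
    cover⇒small {D} y big sub = case outside {D} y big of λ (v , v∈D , v⋪y) → v⋪y (sub v∈D)

    ∪-comm-big : ∀ D D′ → t < ∣ D ∪ D′ ∣ → t < ∣ D′ ∪ D ∣
    ∪-comm-big D D′ big = ≤-trans big (count-mono {D = D ∪ D′} {D′ ∪ D} Sum.swap vs)

    OppositePair : Region V → Set
    OppositePair D = ∃ λ u → u ∈ D × ∃ λ v → v ∈ D × Opposite u v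

    oppositePair? : ∀ D → Dec (OppositePair D)
    oppositePair? D = exists? D λ u → exists? D λ v → ¬? (agree? u v)

    agree-within : ∀ D → ¬ OppositePair D → ∀ {u v} → u ∈ D → v ∈ D → Agree u v
    agree-within D none {u} u∈D v∈D =
      none⇒all D (agree? u) (λ (w , w∈D , opp) → none (u , u∈D , w , w∈D , opp)) v∈D

    -- Two equivalence relations with total union: one of them is total. A vertex `w` agreeing with
    -- `u` only in red cannot agree in red with a `v` that differs from `u` there, so blue links `w`
    -- to `v` and `v` to `u`.
    constant-label : ∀ D {u} → ¬ OppositePair D → u ∈ D → ∃ λ c → ∀ {v} → v ∈ D → label c v ≡ label c u
    constant-label D {u} none u∈D with exists? D (λ v → ¬? (label true v ≟ label true u))
    ... | no all = true , none⇒all D (λ v → label true v ≟ label true u) all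
    ... | yes (v , v∈D , v≢u) = false , λ {w} w∈D →
      go (agree-within D none w∈D u∈D) (agree-within D none w∈D v∈D) (agree-within D none v∈D u∈D)
      where
      go : ∀ {w} → Agree w u → Agree w v → Agree v u → label false w ≡ label false u
      go (false , p) _           _           = p
      go (true , p)  (true , q)  _           = ⊥-elim (v≢u (trans (sym q) p))
      go (true , _)  (false , q) (false , r) = trans q r
      go (true , _)  (false , _) (true , r)  = ⊥-elim (v≢u r)

    -- Red-blue complete bipartite graphs

    data Shape (D₁ D₂ : Region V) : Set where
      mono   : ∀ c ρ → (∀ {u} → u ∈ D₁ ∪ D₂ → label c u ≡ ρ) → Shape D₁ D₂
      point₁ : (∀ {u v} → u ∈ D₁ → v ∈ D₁ → SameType u v) → Shape D₁ D₂
      point₂ : (∀ {u v} → u ∈ D₂ → v ∈ D₂ → SameType u v) → Shape D₁ D₂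
      -- One opposite pair per side is enough: when the sides agree across, `same-or-opposite` then
      -- leaves each side just two types, opposite to each other.
      block  : OppositePair D₁ → OppositePair D₂ → Shape D₁ D₂

    shape : ∀ {D₁ D₂ x y} → x ∈ D₁ → y ∈ D₂ → (∀ {u v} → u ∈ D₁ → v ∈ D₂ → Agree u v) → Shape D₁ D₂
    shape {D₁} {D₂} {x} {y} x∈ y∈ agree with oppositePair? D₁ | oppositePair? D₂
    ... | yes opp₁ | yes opp₂ = block opp₁ opp₂
    -- The pair in `D₁` leaves two opposite types for `D₂`, and `D₂` contains no opposite pair.
    ... | yes (u , u∈ , v , v∈ , opp) | no none₂ = point₂ λ p q →
      [ id , (λ o → ⊥-elim (o (agree-within D₂ none₂ p q))) ]′
        (same-or-opposite opp (agree-sym (agree u∈ p)) (agree-sym (agree v∈ p))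
                              (agree-sym (agree u∈ q)) (agree-sym (agree v∈ q)))
    ... | no none₁ | yes (u , u∈ , v , v∈ , opp) = point₁ λ p q →
      [ id , (λ o → ⊥-elim (o (agree-within D₁ none₁ p q))) ]′
        (same-or-opposite opp (agree p u∈) (agree p v∈) (agree q u∈) (agree q v∈))
    ... | no none₁ | no none₂ with constant-label D₁ none₁ x∈ | constant-label D₂ none₂ y∈
    ...   | c , const₁ | d , const₂ with c Bool.≟ d
    ...     | yes refl with label c x ≟ label c y
    ...       | yes eq = mono c (label c y) [ (λ p → trans (const₁ p) eq) , const₂ ]′
    -- Each side is constant in `c`, but with different labels, so all agreement across is in the
    -- other colour `e`, which is therefore connected.
    ...       | no x≢y with agree x∈ y∈
    ...         | e , eq = mono e (label e y)
      [ (λ p → via (const₁ p) refl (agree p y∈)) , (λ q → trans (sym (via refl (const₂ q) (agree x∈ q))) eq) ]′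
      where
      via : ∀ {u v} → label c u ≡ label c x → label c v ≡ label c y → Agree u v → label e u ≡ label e v
      via u≡x v≡y (e′ , eq′) with either {c} {e} (λ { refl → x≢y eq }) e′
      ... | inj₁ refl = ⊥-elim (x≢y (trans (sym u≡x) (trans eq′ v≡y)))
      ... | inj₂ refl = eq′
    shape {D₁} {D₂} {x} {y} x∈ y∈ agree | no none₁ | no none₂ | c , const₁ | d , const₂ | no c≢d
      with exists? D₁ (λ v → ¬? (label d v ≟ label d y))
    ... | no all = mono d (label d y) [ none⇒all D₁ (λ v → label d v ≟ label d y) all , const₂ ]′
    -- Since `D₂` is constant in `d` and `v` is not in that component, all of `D₂` must agree with
    -- `v` in `c`.
    ... | yes (v , v∈ , v≢y) = point₂ λ p q e → same p q (either c≢d e)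
      where
      at-c : ∀ {w} → w ∈ D₂ → label c w ≡ label c v
      at-c w∈ with e , eq ← agree v∈ w∈ | either c≢d e
      ... | inj₁ refl = sym eq
      ... | inj₂ refl = ⊥-elim (v≢y (trans eq (const₂ w∈)))
      same : ∀ {p q e} → p ∈ D₂ → q ∈ D₂ → e ≡ c ⊎ e ≡ d → label e p ≡ label e q
      same p∈ q∈ (inj₁ refl) = trans (at-c p∈) (sym (at-c q∈))
      same p∈ q∈ (inj₂ refl) = trans (const₂ p∈) (sym (const₂ q∈))

    other-colour : ∀ {c d e : Bool} → d ≢ c → e ≢ c → d ≡ e
    other-colour d≢c e≢c = [ ⊥-elim ∘ d≢c , id ]′ (either (e≢c ∘ sym) _)

    core-other : ∀ {v c d} → v ◁ v → v ∉ S c → d ≢ c → v ∈ S d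
    core-other {v} (e , _ , s) v∉S d≢c =
      subst (λ f → v ∈ S f) (other-colour (λ { refl → v∉S s }) d≢c) s

    edge-other : ∀ {u v} c → ¬ (label c u ≡ label c v × (u ∈ S c ⊎ v ∈ S c)) → Edge u v →
                 ∃ λ d → d ≢ c × label d u ≡ label d v × (u ∈ S d ⊎ v ∈ S d)
    edge-other c not-c (d , eq , s) = d , (λ { refl → not-c (eq , s) }) , eq , s

    -- All of `U₁ ∪ U₂` would lie in the shadow of `y`. Vertices in `S c` do so because `c` is
    -- connected; the others lie in the cover of the second colour, and are linked to `y` in that
    -- colour, directly from `U₁` and through a vertex `a` from `U₂`.
    mono-half : ∀ {U₁ U₂ A c ρ y} → Complete U₁ U₂ → Complete A U₂ →
                t < ∣ U₁ ∪ A ∣ → t < ∣ U₁ ∪ U₂ ∣ → (∀ {u} → u ∈ U₁ ∪ U₂ → label c u ≡ ρ) →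
                (∀ {u} → u ∈ U₁ → u ◁ u) → y ∈ U₂ → y ∉ S c → ⊥
    mono-half {U₁} {U₂} {A} {c} {ρ} {y} UU AU bigUA bigUU const core₁ y∈ y∉S
      -- An edge of colour `c` from `a` to a vertex of `U₂` outside `S c` would be covered by `a`,
      -- placing `a` in the shadow of `y`. So such edges have the second colour.
      with a , a∈ , a⋪y ← outside {U₁ ∪ A} y bigUA
      = cover⇒small {U₁ ∪ U₂} y bigUU [ cover₁ , cover₂ ]′
      where
      edgesUA : ∀ {v} → v ∈ U₂ → ∀ {u} → u ∈ U₁ ∪ A → Edge u v
      edgesUA v∈ = [ (λ p → UU p v∈) , (λ p → AU p v∈) ]′

      core₂ : ∀ {v} → v ∈ U₂ → v ◁ v
      core₂ v∈ = core {U₁ ∪ A} bigUA (edge-sym ∘ edgesUA v∈)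

      same : ∀ {v} → v ∈ U₂ → label c v ≡ label c y
      same v∈ = trans (const (inj₂ v∈)) (sym (const (inj₂ y∈)))

      from-a : ∀ {v} → v ∈ U₂ → v ∉ S c → ∃ λ d → d ≢ c × label d a ≡ label d v
      from-a v∈ v∉S =
        let d , d≢c , eq , _ = edge-other c
              (λ (eq , s) → [ (λ sa → a⋪y (c , trans eq (same v∈) , sa)) , v∉S ]′ s) (edgesUA v∈ a∈)
        in d , d≢c , eq

      cover₂ : ∀ {v} → v ∈ U₂ → v ◁ y
      cover₂ {v} v∈ with mem? (S c) v
      ... | yes s = c , same v∈ , s
      ... | no v∉S with d , d≢c , eq ← from-a v∈ v∉S | e , e≢c , eq′ ← from-a y∈ y∉S
                   with refl ← other-colour d≢c e≢c
        = d , trans (sym eq) eq′ , core-other (core₂ v∈) v∉S d≢c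

      cover₁ : ∀ {u} → u ∈ U₁ → u ◁ y
      cover₁ {u} u∈ with mem? (S c) u
      ... | yes s = c , trans (const (inj₁ u∈)) (sym (const (inj₂ y∈))) , s
      ... | no u∉S with d , d≢c , eq , _ ← edge-other c (λ (_ , s) → [ u∉S , y∉S ]′ s) (UU u∈ y∈)
        = d , eq , core-other (core₁ u∈) u∉S d≢c

    -- Outside a block, some vertex of `D₁`, or a vertex of `D₂` chosen so that edges at it leave
    -- the covering to `D₁`, has all of `D₁` in its shadow.
    shadow-or-block : ∀ {D₁ D₂} → Complete D₁ D₂ → t < ∣ D₂ ∣ →
                      (∃ λ y → ∀ {v} → v ∈ D₁ → v ◁ y) ⊎ (OppositePair D₁ × OppositePair D₂)
    shadow-or-block {D₁} {D₂} K big with inhabited D₂ big | exists? D₁ {λ v → v ≡ v} (λ _ → yes refl)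
    ... | y , _  | no empty = inj₁ (y , λ v∈ → ⊥-elim (empty (_ , v∈ , refl)))
    ... | y , y∈ | yes (x , x∈ , _) with shape {D₁} {D₂} x∈ y∈ (λ p q → edge⇒agree (K p q))
    ...   | block o₁ o₂ = inj₂ (o₁ , o₂)
    ...   | point₁ same = inj₁ (x , λ p → ◁-resp (same p x∈) (core {D₂} big (K p)))
    -- `z` has the components of `y` but avoids its shadow, so every edge from `D₁` to `z` is
    -- covered by its end in `D₁`.
    ...   | point₂ same with z , z∈ , z⋪y ← outside {D₂} y big = inj₁ (y , cover)
      where
      cover : ∀ {v} → v ∈ D₁ → v ◁ y
      cover v∈ with K v∈ z∈
      ... | c , eq , inj₁ s = c , trans eq (same z∈ y∈ c) , s
      ... | c , eq , inj₂ s = ⊥-elim (z⋪y (c , same z∈ y∈ c , s))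
    shadow-or-block {D₁} {D₂} K big | y , y∈ | yes (x , x∈ , _) | mono c ρ const
      with z , z∈ , z⋪y ← outside {D₂} y big = inj₁ (z , cover)
      where
      z∉S : z ∉ S c
      z∉S s = z⋪y (c , trans (const (inj₂ z∈)) (sym (const (inj₂ y∈))) , s)
      cover : ∀ {v} → v ∈ D₁ → v ◁ z
      cover {v} v∈ with mem? (S c) v
      ... | yes s = c , trans (const (inj₁ v∈)) (sym (const (inj₂ z∈))) , s
      ... | no v∉S with d , d≢c , eq , _ ← edge-other c (λ (_ , s) → [ v∉S , z∉S ]′ s) (K v∈ z∈)
        = d , eq , core-other (core {D₂} big (K v∈)) v∉S d≢c

    no-large-biclique : ∀ {D₁ D₂} → Complete D₁ D₂ → t < ∣ D₁ ∣ → t < ∣ D₂ ∣ → 2 * t < ∣ D₁ ∪ D₂ ∣ → ⊥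
    no-large-biclique {D₁} {D₂} K big₁ big₂ big with shadow-or-block {D₁} {D₂} K big₂
    ... | inj₁ (y , cover) = cover⇒small {D₁} y big₁ cover
    ... | inj₂ ((u , u∈ , u′ , u′∈ , opp) , (v , v∈ , v′ , v′∈ , opp′)) =
      -- The components of `u` and `u′` are all the components of the block, so two shadows cover
      -- both sides.
      <⇒≱ big (cover-size {D₁ ∪ D₂} (u ∷ u′ ∷ []) λ p → fromSum ([ cover₁ , cover₂ ]′ p))
      where
      fromSum : ∀ {w} → w ◁ u ⊎ w ◁ u′ → Any (w ◁_) (u ∷ u′ ∷ [])
      fromSum = [ here , there ∘ here ]′
      agree : ∀ {p q} → p ∈ D₁ → q ∈ D₂ → Agree p q
      agree p∈ q∈ = edge⇒agree (K p∈ q∈)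
      cover₂ : ∀ {w} → w ∈ D₂ → w ◁ u ⊎ w ◁ u′
      cover₂ w∈ = ◁-mix opp (agree-sym (agree u∈ w∈)) (agree-sym (agree u′∈ w∈))
                            (core {D₁} big₁ (λ p → edge-sym (K p w∈)))
      cover₁ : ∀ {w} → w ∈ D₁ → w ◁ u ⊎ w ◁ u′
      cover₁ w∈ with ◁-mix opp′ (agree w∈ v∈) (agree w∈ v′∈) (core {D₂} big₂ (K w∈))
      ... | inj₁ p = ◁-split opp (agree-sym (agree u∈ v∈)) (agree-sym (agree u′∈ v∈)) p
      ... | inj₂ p = ◁-split opp (agree-sym (agree u∈ v′∈)) (agree-sym (agree u′∈ v′∈)) p

    -- `x` agrees with `y₀` in colour `c`. An edge from `x` to a vertex of `A` outside the shadow of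
    -- `y₀` cannot have colour `c`, since neither end could cover it. So these vertices of `A` share
    -- one component of the other colour `d`.
    two-shadows : ∀ {y₀ U A V} → Complete U A → Complete V A → t < ∣ U ∪ V ∣ →
                  (∀ {u} → u ∈ U → Agree u y₀) → (∀ {u} → u ∈ U → u ◁ u) →
                  (∃ λ x → x ∈ U × ¬ x ◁ y₀) → (∃ λ a → a ∈ A × ¬ a ◁ y₀) →
                  ∃ λ y → y ∈ A × (∀ {v} → v ∈ U ∪ A → v ◁ y₀ ⊎ v ◁ y)
    two-shadows {y₀} {U} {A} {V} UA VA big agree coreU (x , x∈ , x⋪) (a₀ , a₀∈ , a₀⋪)
      with c , x~y₀ ← agree x∈
      with d , d≢c , x~a₀ , _ ← edge-other c
             (λ (eq , s) → [ (λ s → x⋪ (c , x~y₀ , s)) , (λ s → a₀⋪ (c , trans (sym eq) x~y₀ , s)) ]′ s) (UA x∈ a₀∈)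
      -- If the vertices of `A` outside the shadow of `y₀` are all in `S d`, any of them, such as
      -- `a₀`, can be `y`. Otherwise `y` is one outside `S d`.
      with exists? A (λ a → ¬? (a ◁? y₀) ×-dec ¬? (mem? (S d) a))
    ... | no none = a₀ , a₀∈ , [ (λ p → ◁-transfer (agree p) (UA p a₀∈) a₀⋪ (coreU p)) , coverA ]′
      where
      coverA : ∀ {a} → a ∈ A → a ◁ y₀ ⊎ a ◁ a₀
      coverA {a} a∈ with a ◁? y₀ | mem? (S d) a
      ... | yes p | _      = inj₁ p
      ... | no a⋪ | no a∉S = ⊥-elim (none (a , a∈ , a⋪ , a∉S))
      ... | no a⋪ | yes s with e , e≢c , x~a , _ ← edge-other c
              (λ (eq , s) → [ (λ s → x⋪ (c , x~y₀ , s)) , (λ s → a⋪ (c , trans (sym eq) x~y₀ , s)) ]′ s) (UA x∈ a∈)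
              with refl ← other-colour d≢c e≢c
        = inj₂ (d , trans (sym x~a) x~a₀ , s)
    -- `z` avoids the shadow of `y`, so it reaches the remaining vertices outside `S d` only in the
    -- colour other than `d`. This puts them in one component with `y`.
    ... | yes (y , y∈ , y⋪ , y∉S) with z , z∈ , z⋪ ← outside {U ∪ V} y big
      = y , y∈ , [ (λ p → ◁-transfer (agree p) (UA p y∈) y⋪ (coreU p)) , coverA ]′
      where
      edgesA : ∀ {a} → a ∈ A → ∀ {u} → u ∈ U ∪ V → Edge u a
      edgesA a∈ = [ (λ p → UA p a∈) , (λ p → VA p a∈) ]′

      from-x : ∀ {a} → a ∈ A → ¬ a ◁ y₀ → label d x ≡ label d a
      from-x a∈ a⋪ with e , e≢c , x~a , _ ← edge-other c
              (λ (eq , s) → [ (λ s → x⋪ (c , x~y₀ , s)) , (λ s → a⋪ (c , trans (sym eq) x~y₀ , s)) ]′ s) (UA x∈ a∈)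
              with refl ← other-colour d≢c e≢c = x~a

      same-d : ∀ {a} → a ∈ A → ¬ a ◁ y₀ → label d a ≡ label d y
      same-d a∈ a⋪ = trans (sym (from-x a∈ a⋪)) (from-x y∈ y⋪)

      from-z : ∀ {a} → a ∈ A → ¬ a ◁ y₀ → a ∉ S d → ∃ λ e → e ≢ d × label e z ≡ label e a
      from-z a∈ a⋪ a∉S with e , e≢d , z~a , _ ← edge-other d
              (λ (eq , s) → [ (λ s → z⋪ (d , trans eq (same-d a∈ a⋪) , s)) , a∉S ]′ s) (edgesA a∈ z∈)
        = e , e≢d , z~a

      coverA : ∀ {a} → a ∈ A → a ◁ y₀ ⊎ a ◁ y
      coverA {a} a∈ with a ◁? y₀ | mem? (S d) a
      ... | yes p | _     = inj₁ p
      ... | no a⋪ | yes s = inj₂ (d , same-d a∈ a⋪ , s)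
      ... | no a⋪ | no a∉S with e , e≢d , z~a ← from-z a∈ a⋪ a∉S | f , f≢d , z~y ← from-z y∈ y⋪ y∉S
              with refl ← other-colour e≢d f≢d
        = inj₂ (e , trans (sym z~a) z~y , core-other (core {U ∪ V} big (edge-sym ∘ edgesA a∈)) a∉S e≢d)

    -- The path V₁ – A₂ – U₁ – U₂ – A₁ – V₂ with each vertex blown up to a region; indices give the side.
    record Zigzag (V₁ A₂ U₁ U₂ A₁ V₂ : Region V) : Set where
      field
        v₁a₂ : Complete V₁ A₂
        u₁a₂ : Complete U₁ A₂
        u₁u₂ : Complete U₁ U₂
        a₁u₂ : Complete A₁ U₂
        a₁v₂ : Complete A₁ V₂
        u₁∪v₁ : t < ∣ U₁ ∪ V₁ ∣
        u₁∪a₁ : t < ∣ U₁ ∪ A₁ ∣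
        u₁∪u₂ : t < ∣ U₁ ∪ U₂ ∣
        u₂∪a₂ : t < ∣ U₂ ∪ A₂ ∣
        u₂∪v₂ : t < ∣ U₂ ∪ V₂ ∣
        u₁ : ∃ λ u → u ∈ U₁
        u₂ : ∃ λ u → u ∈ U₂

    flip-zigzag : ∀ {V₁ A₂ U₁ U₂ A₁ V₂} → Zigzag V₁ A₂ U₁ U₂ A₁ V₂ → Zigzag V₂ A₁ U₂ U₁ A₂ V₁
    flip-zigzag {U₁ = U₁} {U₂} Z = record
      { v₁a₂ = λ p q → edge-sym (a₁v₂ q p) ; u₁a₂ = λ p q → edge-sym (a₁u₂ q p)
      ; u₁u₂ = λ p q → edge-sym (u₁u₂ q p) ; a₁u₂ = λ p q → edge-sym (u₁a₂ q p)
      ; a₁v₂ = λ p q → edge-sym (v₁a₂ q p)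
      ; u₁∪v₁ = u₂∪v₂ ; u₁∪a₁ = u₂∪a₂ ; u₁∪u₂ = ∪-comm-big U₁ U₂ u₁∪u₂
      ; u₂∪a₂ = u₁∪a₁ ; u₂∪v₂ = u₁∪v₁ ; u₁ = u₂ ; u₂ = u₁ }
      where open Zigzag Z

    module ZigzagProperties {V₁ A₂ U₁ U₂ A₁ V₂} (Z : Zigzag V₁ A₂ U₁ U₂ A₁ V₂) where
      open Zigzag Z public

      core-u₁ : ∀ {v} → v ∈ U₁ → v ◁ v
      core-u₁ p = core {U₂ ∪ A₂} u₂∪a₂ [ u₁u₂ p , u₁a₂ p ]′

      core-u₂ : ∀ {v} → v ∈ U₂ → v ◁ v
      core-u₂ p = core {U₁ ∪ A₁} u₁∪a₁ [ (λ q → edge-sym (u₁u₂ q p)) , (λ q → edge-sym (a₁u₂ q p)) ]′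

      core-a₁ : ∀ {v} → v ∈ A₁ → v ◁ v
      core-a₁ p = core {U₂ ∪ V₂} u₂∪v₂ [ a₁u₂ p , a₁v₂ p ]′

      core-a₂ : ∀ {v} → v ∈ A₂ → v ◁ v
      core-a₂ p = core {U₁ ∪ V₁} u₁∪v₁ [ (λ q → edge-sym (u₁a₂ q p)) , (λ q → edge-sym (v₁a₂ q p)) ]′

      outside-u₁ : ∀ {y} → (∀ {u} → u ∈ U₂ → u ◁ y) → ∃ λ x → x ∈ U₁ × ¬ x ◁ y
      outside-u₁ {y} cover with outside {U₁ ∪ U₂} y u₁∪u₂
      ... | x , inj₁ x∈ , x⋪ = x , x∈ , x⋪
      ... | x , inj₂ x∈ , x⋪ = ⊥-elim (x⋪ (cover x∈))

      outside-a₂ : ∀ {y} → (∀ {u} → u ∈ U₂ → u ◁ y) → ∃ λ x → x ∈ A₂ × ¬ x ◁ y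
      outside-a₂ {y} cover with outside {U₂ ∪ A₂} y u₂∪a₂
      ... | x , inj₂ x∈ , x⋪ = x , x∈ , x⋪
      ... | x , inj₁ x∈ , x⋪ = ⊥-elim (x⋪ (cover x∈))

      outside-v₂ : ∀ {y} → (∀ {u} → u ∈ U₂ → u ◁ y) → ∃ λ x → x ∈ V₂ × ¬ x ◁ y
      outside-v₂ {y} cover with outside {U₂ ∪ V₂} y u₂∪v₂
      ... | x , inj₂ x∈ , x⋪ = x , x∈ , x⋪
      ... | x , inj₁ x∈ , x⋪ = ⊥-elim (x⋪ (cover x∈))

      -- A vertex outside the shadow of `y₀` but in its component of colour `c` is outside `S c`, so
      -- `mono-half` applies to the side containing it.
      not-mono : ∀ {c ρ} → ¬ (∀ {u} → u ∈ U₁ ∪ U₂ → label c u ≡ ρ)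
      not-mono {c} const with y₀ , y₀∈ ← u₂ with outside {U₁ ∪ U₂} y₀ u₁∪u₂
      ... | y , inj₂ y∈ , y⋪ = mono-half {U₁} {U₂} {A₁} u₁u₂ a₁u₂ u₁∪a₁ u₁∪u₂ const core-u₁ y∈
              (λ s → y⋪ (c , trans (const (inj₂ y∈)) (sym (const (inj₂ y₀∈))) , s))
      ... | y , inj₁ y∈ , y⋪ = mono-half {U₂} {U₁} {A₂} (λ p q → edge-sym (u₁u₂ q p)) (λ p q → edge-sym (u₁a₂ q p))
              u₂∪a₂ (∪-comm-big U₁ U₂ u₁∪u₂) (const ∘ Sum.swap) core-u₂ y∈
              (λ s → y⋪ (c , trans (const (inj₁ y∈)) (sym (const (inj₂ y₀∈))) , s))

      module OneType (same : ∀ {u v} → u ∈ U₂ → v ∈ U₂ → SameType u v) where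

        y₀ : V
        y₀ = proj₁ u₂

        cover-u₂ : ∀ {v} → v ∈ U₂ → v ◁ y₀
        cover-u₂ v∈ = ◁-resp (same v∈ (proj₂ u₂)) (core-u₂ v∈)

        agree-u₁ : ∀ {v} → v ∈ U₁ → Agree v y₀
        agree-u₁ v∈ = edge⇒agree (u₁u₂ v∈ (proj₂ u₂))

        agree-a₁ : ∀ {v} → v ∈ A₁ → Agree v y₀
        agree-a₁ v∈ = edge⇒agree (a₁u₂ v∈ (proj₂ u₂))

        cover-u₁a₂ : ∃ λ y → y ∈ A₂ × (∀ {v} → v ∈ U₁ ∪ A₂ → v ◁ y₀ ⊎ v ◁ y)
        cover-u₁a₂ = two-shadows {U = U₁} {A₂} {V₁} u₁a₂ v₁a₂ u₁∪v₁ agree-u₁ core-u₁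
                                 (outside-u₁ cover-u₂) (outside-a₂ cover-u₂)

        cover-a₁ : ∃ λ y → ∀ {v} → v ∈ A₁ → v ◁ y₀ ⊎ v ◁ y
        cover-a₁ with y , y∈ , y⋪ ← outside-v₂ cover-u₂
          = y , λ p → ◁-transfer (agree-a₁ p) (a₁v₂ p y∈) y⋪ (core-a₁ p)

        size≤3t : ∣ (U₁ ∪ A₁) ∪ (U₂ ∪ A₂) ∣ ≤ 3 * t
        size≤3t with y , _ , cover-y ← cover-u₁a₂ | z , cover-z ← cover-a₁
          = cover-size {(U₁ ∪ A₁) ∪ (U₂ ∪ A₂)} (y₀ ∷ y ∷ z ∷ []) λ where
              (inj₁ (inj₁ p)) → [ here , there ∘ here ]′ (cover-y (inj₁ p))
              (inj₁ (inj₂ p)) → [ here , there ∘ there ∘ here ]′ (cover-z p)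
              (inj₂ (inj₁ p)) → here (cover-u₂ p)
              (inj₂ (inj₂ p)) → [ here , there ∘ here ]′ (cover-y (inj₂ p))

      module Opposites {u u′ v v′} (u∈ : u ∈ U₁) (u′∈ : u′ ∈ U₁) (u-u′ : Opposite u u′)
                       (v∈ : v ∈ U₂) (v′∈ : v′ ∈ U₂) (v-v′ : Opposite v v′) where

        -- `x` is adjacent to both `u` and `u′`, so it has no component besides theirs. `shadow-u⊆`
        -- reaches the same two shadows by way of `v` and `v′`.
        shadow-v⊆ : ∀ {w x} → x ∈ U₂ ∪ A₂ → w ◁ x → w ◁ u ⊎ w ◁ u′
        shadow-v⊆ x∈ = ◁-split u-u′ (edge⇒agree (edge-sym (edge u∈ x∈))) (edge⇒agree (edge-sym (edge u′∈ x∈)))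
          where
          edge : ∀ {w x} → w ∈ U₁ → x ∈ U₂ ∪ A₂ → Edge w x
          edge p = [ u₁u₂ p , u₁a₂ p ]′

        shadow-u⊆ : ∀ {w x} → x ∈ U₁ ∪ A₁ → w ◁ x → w ◁ u ⊎ w ◁ u′
        shadow-u⊆ x∈ p = [ shadow-v⊆ (inj₁ v∈) , shadow-v⊆ (inj₁ v′∈) ]′
                           (◁-split v-v′ (edge⇒agree (edge x∈ v∈)) (edge⇒agree (edge x∈ v′∈)) p)
          where
          edge : ∀ {w x} → w ∈ U₁ ∪ A₁ → x ∈ U₂ → Edge w x
          edge q r = [ (λ q → u₁u₂ q r) , (λ q → a₁u₂ q r) ]′ q

        cover₁ : ∀ {w} → w ∈ U₁ ∪ A₁ → w ◁ u ⊎ w ◁ u′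
        cover₁ w∈ = shadow-u⊆ w∈ ([ core-u₁ , core-a₁ ]′ w∈)

        cover₂ : ∀ {w} → w ∈ U₂ ∪ A₂ → w ◁ u ⊎ w ◁ u′
        cover₂ w∈ = shadow-v⊆ w∈ ([ core-u₂ , core-a₂ ]′ w∈)

    shadows₂ : ∀ {w a b} → w ◁ a ⊎ w ◁ b → w ∈ shadows (a ∷ b ∷ [])
    shadows₂ = [ here , there ∘ here ]′

    no-zigzag : ∀ {V₁ A₂ U₁ U₂ A₁ V₂} → Zigzag V₁ A₂ U₁ U₂ A₁ V₂ → 3 * t < ∣ (U₁ ∪ A₁) ∪ (U₂ ∪ A₂) ∣ → ⊥
    no-zigzag {V₁} {A₂} {U₁} {U₂} {A₁} {V₂} Z big
      with shape {U₁} {U₂} (proj₂ (Zigzag.u₁ Z)) (proj₂ (Zigzag.u₂ Z)) (λ p q → edge⇒agree (Zigzag.u₁u₂ Z p q))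
    ... | mono c ρ const = ZigzagProperties.not-mono Z const
    ... | point₂ same = <⇒≱ big (ZigzagProperties.OneType.size≤3t Z same)
    ... | point₁ same = <⇒≱ big (≤-trans
            (count-mono {D = (U₁ ∪ A₁) ∪ (U₂ ∪ A₂)} {(U₂ ∪ A₂) ∪ (U₁ ∪ A₁)} Sum.swap vs)
            (ZigzagProperties.OneType.size≤3t (flip-zigzag Z) same))
    ... | block (u , u∈ , u′ , u′∈ , opp) (v , v∈ , v′ , v′∈ , opp′) = <⇒≱ big (≤-trans
            (cover-size {(U₁ ∪ A₁) ∪ (U₂ ∪ A₂)} (u ∷ u′ ∷ []) (shadows₂ ∘ [ cover₁ , cover₂ ]′))
            (m≤n+m (2 * t) t))
      where
      open ZigzagProperties Z
      open Opposites u∈ u′∈ opp v∈ v′∈ opp′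

    -- The zigzag closed up by the edges V₁ – V₂.
    record Hexagon (V₁ A₂ U₁ U₂ A₁ V₂ : Region V) : Set where
      field
        zigzag : Zigzag V₁ A₂ U₁ U₂ A₁ V₂
        v₁v₂ : Complete V₁ V₂
        a₁∪v₁ : t < ∣ A₁ ∪ V₁ ∣
        a₂∪v₂ : t < ∣ A₂ ∪ V₂ ∣
        a₁∪u₂ : t < ∣ A₁ ∪ U₂ ∣
        a₂∪u₁ : t < ∣ A₂ ∪ U₁ ∣
        a₁ : ∃ λ a → a ∈ A₁
        a₂ : ∃ λ a → a ∈ A₂

    flip-hexagon : ∀ {V₁ A₂ U₁ U₂ A₁ V₂} → Hexagon V₁ A₂ U₁ U₂ A₁ V₂ → Hexagon V₂ A₁ U₂ U₁ A₂ V₁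
    flip-hexagon H = record
      { zigzag = flip-zigzag zigzag ; v₁v₂ = λ p q → edge-sym (v₁v₂ q p)
      ; a₁∪v₁ = a₂∪v₂ ; a₂∪v₂ = a₁∪v₁ ; a₁∪u₂ = a₂∪u₁ ; a₂∪u₁ = a₁∪u₂ ; a₁ = a₂ ; a₂ = a₁ }
      where open Hexagon H

    -- One of the two shadows can be prescribed: in a block, D₂ consists of two opposite types.
    second-shadow : ∀ {D₁ D₂ y} → Complete D₁ D₂ → t < ∣ D₂ ∣ → y ∈ D₂ →
                    ∃ λ z → ∀ {v} → v ∈ D₁ → v ◁ y ⊎ v ◁ z
    second-shadow {D₁} {D₂} {y} K big y∈ with shadow-or-block {D₁} {D₂} K big
    ... | inj₁ (z , cover) = z , inj₂ ∘ cover
    ... | inj₂ ((u , u∈ , u′ , u′∈ , opp) , (v , v∈ , v′ , v′∈ , opp′)) =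
      case same-or-opposite opp (agree u∈ y∈) (agree u′∈ y∈) (agree u∈ v∈) (agree u′∈ v∈) of λ where
        (inj₂ y-v) → v , λ {_} w∈ → ◁-mix y-v (agree′ w∈ y∈) (agree′ w∈ v∈) (core {D₂} big (K w∈))
        (inj₁ y≈v) → v′ , λ {_} w∈ → [ (λ p → inj₁ (◁-resp (λ c → sym (y≈v c)) p)) , inj₂ ]′
          (◁-mix opp′ (agree′ w∈ v∈) (agree′ w∈ v′∈) (core {D₂} big (K w∈)))
      where
      agree′ : ∀ {p q} → p ∈ D₁ → q ∈ D₂ → Agree p q
      agree′ p∈ q∈ = edge⇒agree (K p∈ q∈)
      agree : ∀ {p q} → p ∈ D₁ → q ∈ D₂ → Agree q p
      agree p∈ q∈ = agree-sym (agree′ p∈ q∈)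

    module HexagonProperties {V₁ A₂ U₁ U₂ A₁ V₂} (H : Hexagon V₁ A₂ U₁ U₂ A₁ V₂) where
      open Hexagon H public
      open ZigzagProperties zigzag public

      cover-v₁ : ∀ {y} → y ∈ A₂ ∪ V₂ → ∃ λ z → ∀ {v} → v ∈ V₁ → v ◁ y ⊎ v ◁ z
      cover-v₁ y∈ = second-shadow {V₁} {A₂ ∪ V₂} (λ p → [ v₁a₂ p , v₁v₂ p ]′) a₂∪v₂ y∈

      cover-v₂ : ∀ {y} → y ∈ A₁ ∪ V₁ → ∃ λ z → ∀ {v} → v ∈ V₂ → v ◁ y ⊎ v ◁ z
      cover-v₂ y∈ = second-shadow {V₂} {A₁ ∪ V₁}
        (λ p → [ (λ q → edge-sym (a₁v₂ q p)) , (λ q → edge-sym (v₁v₂ q p)) ]′) a₁∪v₁ y∈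

      outside-a₁ : ∀ {y} → (∀ {u} → u ∈ U₂ → u ◁ y) → ∃ λ x → x ∈ A₁ × ¬ x ◁ y
      outside-a₁ {y} cover with outside {A₁ ∪ U₂} y a₁∪u₂
      ... | x , inj₁ x∈ , x⋪ = x , x∈ , x⋪
      ... | x , inj₂ x∈ , x⋪ = ⊥-elim (x⋪ (cover x∈))

      everywhere : Region V
      everywhere = (U₁ ∪ A₁ ∪ V₁) ∪ (U₂ ∪ A₂ ∪ V₂)

      -- The shadow of `y₀` contains `U₂`; adding that of `y` covers `U₁` and `A₂`, and adding that
      -- of `z` covers `A₁` and `V₂`.
      one-type : (∀ {u v} → u ∈ U₂ → v ∈ U₂ → SameType u v) → ∣ everywhere ∣ ≤ 4 * t
      one-type same
        with y , y∈ , cover-y ← OneType.cover-u₁a₂ same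
        with z , _ , cover-z ← two-shadows {U = A₁} {V₂} {V₁} a₁v₂ v₁v₂ a₁∪v₁ (OneType.agree-a₁ same) core-a₁
                                           (outside-a₁ (OneType.cover-u₂ same)) (outside-v₂ (OneType.cover-u₂ same))
        -- Since `y` lies in `A₂`, it can be the prescribed vertex for `V₁`, and only the shadow of
        -- `w` is new.
        with w , cover-w ← cover-v₁ (inj₁ y∈)
        = cover-size {everywhere} (y₀ ∷ y ∷ z ∷ w ∷ []) λ where
            (inj₁ (inj₁ p))        → [ here , there ∘ here ]′ (cover-y (inj₁ p))
            (inj₁ (inj₂ (inj₁ p))) → [ here , there ∘ there ∘ here ]′ (cover-z (inj₁ p))
            (inj₁ (inj₂ (inj₂ p))) → [ there ∘ here , there ∘ there ∘ there ∘ here ]′ (cover-w p)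
            (inj₂ (inj₁ p))        → here (cover-u₂ p)
            (inj₂ (inj₂ (inj₁ p))) → [ here , there ∘ here ]′ (cover-y (inj₂ p))
            (inj₂ (inj₂ (inj₂ p))) → [ here , there ∘ there ∘ here ]′ (cover-z (inj₂ p))
        where open OneType same

      -- Two shadows cover everything but `V₁` and `V₂`. Each of these needs just one more, as the
      -- prescribed vertices `b` and `a` have shadows inside those of `u` and `u′`.
      opposites : OppositePair U₁ → OppositePair U₂ → ∣ everywhere ∣ ≤ 4 * t
      opposites (u , u∈ , u′ , u′∈ , opp) (v , v∈ , v′ , v′∈ , opp′)
        with b , b∈ ← a₂ | a , a∈ ← a₁
        with z , cover-z ← cover-v₁ (inj₁ b∈) | w , cover-w ← cover-v₂ (inj₁ a∈)
        = cover-size {everywhere} (u ∷ u′ ∷ z ∷ w ∷ []) λ where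
            (inj₁ (inj₁ p))        → core⊆ (cover₁ (inj₁ p))
            (inj₁ (inj₂ (inj₁ p))) → core⊆ (cover₁ (inj₂ p))
            (inj₁ (inj₂ (inj₂ p))) → [ (λ q → core⊆ (shadow-v⊆ (inj₂ b∈) q)) , there ∘ there ∘ here ]′ (cover-z p)
            (inj₂ (inj₁ p))        → core⊆ (cover₂ (inj₁ p))
            (inj₂ (inj₂ (inj₁ p))) → core⊆ (cover₂ (inj₂ p))
            (inj₂ (inj₂ (inj₂ p))) → [ (λ q → core⊆ (shadow-u⊆ (inj₂ a∈) q)) , there ∘ there ∘ there ∘ here ]′ (cover-w p)
        where
        open Opposites u∈ u′∈ opp v∈ v′∈ opp′
        core⊆ : ∀ {x y z} → x ◁ u ⊎ x ◁ u′ → x ∈ shadows (u ∷ u′ ∷ y ∷ z ∷ [])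
        core⊆ = [ here , there ∘ here ]′

    no-hexagon : ∀ {V₁ A₂ U₁ U₂ A₁ V₂} → Hexagon V₁ A₂ U₁ U₂ A₁ V₂ →
                 4 * t < ∣ (U₁ ∪ A₁ ∪ V₁) ∪ (U₂ ∪ A₂ ∪ V₂) ∣ → ⊥
    no-hexagon {V₁} {A₂} {U₁} {U₂} {A₁} {V₂} H big
      with shape {U₁} {U₂} (proj₂ (HexagonProperties.u₁ H)) (proj₂ (HexagonProperties.u₂ H))
                 (λ p q → edge⇒agree (HexagonProperties.u₁u₂ H p q))
    ... | mono c ρ const = HexagonProperties.not-mono H const
    ... | point₂ same = <⇒≱ big (HexagonProperties.one-type H same)
    ... | point₁ same = <⇒≱ big (≤-trans
            (count-mono {D = (U₁ ∪ A₁ ∪ V₁) ∪ (U₂ ∪ A₂ ∪ V₂)} {(U₂ ∪ A₂ ∪ V₂) ∪ (U₁ ∪ A₁ ∪ V₁)} Sum.swap vs)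
            (HexagonProperties.one-type (flip-hexagon H) same))
    ... | block o₁ o₂ = <⇒≱ big (HexagonProperties.opposites H o₁ o₂)

-- König's theorem

module Koenig (n : ℕ) where
  open import Data.List.Membership.DecPropositional (Fin._≟_ {n}) using (_∈?_)

  private
    I : Set
    I = Fin n

  InjectiveOn : List I → (I → I) → Set
  InjectiveOn ps f = ∀ {p q} → p ∈ˡ ps → q ∈ˡ ps → f p ≡ f q → p ≡ q

  update : (I → I) → I → I → I → I
  update f i j p with p Fin.≟ i
  ... | yes _ = j
  ... | no _  = f p

  update-cases : ∀ f i j p → (p ≡ i × update f i j p ≡ j) ⊎ (p ≢ i × update f i j p ≡ f p)
  update-cases f i j p with p Fin.≟ i
  ... | yes p≡i = inj₁ (p≡i , refl)
  ... | no p≢i  = inj₂ (p≢i , refl)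

  module _ {E : I → I → Set} (E? : ∀ i j → Dec (E i j)) where

    -- Hall's alternative. The deficient case retains a matching of `ts` onto the neighbourhood of
    -- `x ∷ ts`, whose edges later serve König's theorem.
    data Hall (ps : List I) : Set where
      saturated : ∀ f → (∀ {p} → p ∈ˡ ps → E p (f p)) → InjectiveOn ps f → Hall ps
      deficient : ∀ x ts f → x ∈ˡ ps → (∀ {p} → p ∈ˡ ts → p ∈ˡ ps) →
                  (∀ {p} → p ∈ˡ ts → E p (f p)) → InjectiveOn ts f →
                  (∀ {p j} → p ∈ˡ x ∷ ts → E p j → j ∈ˡ map f ts) → Hall ps

    module Augment (ps : List I) (x : I) (f : I → I) (f-edge : ∀ {p} → p ∈ˡ ps → E p (f p))
                   (f-inj : InjectiveOn ps f) where

      -- A matching saturating x ∷ ps except i, differing from f only inside f (ts).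
      record Exposed (ts : List I) (i : I) : Set where
        field
          match : I → I
          edge  : ∀ {p} → p ∈ˡ x ∷ ps → p ≢ i → E p (match p)
          inj   : ∀ {p q} → p ∈ˡ x ∷ ps → q ∈ˡ x ∷ ps → p ≢ i → q ≢ i → match p ≡ match q → p ≡ q
          near  : ∀ {p} → p ∈ˡ x ∷ ps → p ≢ i → match p ∈ˡ map f ts ⊎ (p ∈ˡ ps × match p ≡ f p)

      exposed-x : ∀ {ts} → Exposed ts x
      exposed-x = record
        { match = f
        ; edge = λ p∈ p≢x → f-edge (tail p∈ p≢x)
        ; inj = λ p∈ q∈ p≢x q≢x → f-inj (tail p∈ p≢x) (tail q∈ q≢x)
        ; near = λ p∈ p≢x → inj₂ (tail p∈ p≢x , refl) }
        where
        tail : ∀ {p} → p ∈ˡ x ∷ ps → p ≢ x → p ∈ˡ ps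
        tail (here p≡x) p≢x = ⊥-elim (p≢x p≡x)
        tail (there p∈) _ = p∈

      exposed-there : ∀ {ts y i} → Exposed ts i → Exposed (y ∷ ts) i
      exposed-there e = record { Exposed e ; near = λ p∈ p≢i → Sum.map₁ there (Exposed.near e p∈ p≢i) }

      -- Moving i to the neighbour f y frees y.
      exposed-step : ∀ {ts i y} → Exposed ts i → E i (f y) → ¬ f y ∈ˡ map f ts → y ∈ˡ ps → Exposed (y ∷ ts) y
      exposed-step {ts} {i} {y} e Eify fresh y∈ = record
        { match = m ; edge = edge′ ; inj = inj′ ; near = near′ }
        where
        open Exposed e
        m : I → I
        m = update match i (f y)
        edge′ : ∀ {p} → p ∈ˡ x ∷ ps → p ≢ y → E p (m p)
        edge′ {p} p∈ p≢y with update-cases match i (f y) p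
        ... | inj₁ (refl , eq) = subst (E p) (sym eq) Eify
        ... | inj₂ (p≢i , eq)  = subst (E p) (sym eq) (edge p∈ p≢i)
        avoid : ∀ {p} → p ∈ˡ x ∷ ps → p ≢ i → p ≢ y → match p ≢ f y
        avoid p∈ p≢i p≢y eq with near p∈ p≢i
        ... | inj₁ old = fresh (subst (_∈ˡ map f ts) eq old)
        ... | inj₂ (p∈ps , eq′) = p≢y (f-inj p∈ps y∈ (trans (sym eq′) eq))
        inj′ : ∀ {p q} → p ∈ˡ x ∷ ps → q ∈ˡ x ∷ ps → p ≢ y → q ≢ y → m p ≡ m q → p ≡ q
        inj′ {p} {q} p∈ q∈ p≢y q≢y eq with update-cases match i (f y) p | update-cases match i (f y) q
        ... | inj₁ (p≡i , _)   | inj₁ (q≡i , _)   = trans p≡i (sym q≡i)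
        ... | inj₁ (_ , eqp)   | inj₂ (q≢i , eqq) = ⊥-elim (avoid q∈ q≢i q≢y (trans (sym eqq) (trans (sym eq) eqp)))
        ... | inj₂ (p≢i , eqp) | inj₁ (_ , eqq)   = ⊥-elim (avoid p∈ p≢i p≢y (trans (sym eqp) (trans eq eqq)))
        ... | inj₂ (p≢i , eqp) | inj₂ (q≢i , eqq) = inj p∈ q∈ p≢i q≢i (trans (sym eqp) (trans eq eqq))
        near′ : ∀ {p} → p ∈ˡ x ∷ ps → p ≢ y → m p ∈ˡ map f (y ∷ ts) ⊎ (p ∈ˡ ps × m p ≡ f p)
        near′ {p} p∈ p≢y with update-cases match i (f y) p
        ... | inj₁ (_ , eq) = inj₁ (here eq)
        ... | inj₂ (p≢i , eq) = Sum.map (λ q → there (subst (_∈ˡ map f ts) (sym eq) q))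
                                        (λ (q , eq′) → q , trans eq eq′) (near p∈ p≢i)

      -- By `near`, the matching that exposes `i` uses only values of `f`, so `j` is still free for
      -- `i`: an augmenting path ends here.
      saturate : ∀ {ts i j} → Exposed ts i → E i j → ¬ j ∈ˡ map f ts → (∀ {p} → p ∈ˡ ps → f p ≢ j) → Hall (x ∷ ps)
      saturate {ts} {i} {j} e Eij fresh free = saturated m edge′ inj′
        where
        open Exposed e
        m : I → I
        m = update match i j
        edge′ : ∀ {p} → p ∈ˡ x ∷ ps → E p (m p)
        edge′ {p} p∈ with update-cases match i j p
        ... | inj₁ (refl , eq) = subst (E p) (sym eq) Eij
        ... | inj₂ (p≢i , eq)  = subst (E p) (sym eq) (edge p∈ p≢i)
        avoid : ∀ {p} → p ∈ˡ x ∷ ps → p ≢ i → match p ≢ j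
        avoid p∈ p≢i eq with near p∈ p≢i
        ... | inj₁ old = fresh (subst (_∈ˡ map f ts) eq old)
        ... | inj₂ (p∈ps , eq′) = free p∈ps (trans (sym eq′) eq)
        inj′ : InjectiveOn (x ∷ ps) m
        inj′ {p} {q} p∈ q∈ eq with update-cases match i j p | update-cases match i j q
        ... | inj₁ (p≡i , _)   | inj₁ (q≡i , _)   = trans p≡i (sym q≡i)
        ... | inj₁ (_ , eqp)   | inj₂ (q≢i , eqq) = ⊥-elim (avoid q∈ q≢i (trans (sym eqq) (trans (sym eq) eqp)))
        ... | inj₂ (p≢i , eqp) | inj₁ (_ , eqq)   = ⊥-elim (avoid p∈ p≢i (trans (sym eqp) (trans eq eqq)))
        ... | inj₂ (p≢i , eqp) | inj₂ (q≢i , eqq) = inj p∈ q∈ p≢i q≢i (trans (sym eqp) (trans eq eqq))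

      -- Alternating search from `x`, with `ts` reached and `rs` unreached. A new neighbour `j` of a
      -- reached vertex is either free, and the matching is augmented, or the partner of some `y` in
      -- `rs`, which becomes reached. With no new neighbour, `x ∷ ts` is deficient.
      grow : ∀ fuel ts rs → length rs ≤ fuel → (∀ {p} → p ∈ˡ ts → p ∈ˡ ps) → (∀ {p} → p ∈ˡ rs → p ∈ˡ ps) →
             (∀ {p} → p ∈ˡ ps → p ∈ˡ ts ⊎ p ∈ˡ rs) → (∀ {i} → i ∈ˡ x ∷ ts → Exposed ts i) → Hall (x ∷ ps)
      grow fuel ts rs len ts⊆ rs⊆ split exposed
        with Any.any? (λ i → Fin.any? λ j → E? i j ×-dec ¬? (j ∈? map f ts)) (x ∷ ts)
      ... | no closed = deficient x ts f (here refl) (there ∘ ts⊆) (f-edge ∘ ts⊆)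
              (λ p∈ q∈ → f-inj (ts⊆ p∈) (ts⊆ q∈)) inside
        where
        inside : ∀ {p j} → p ∈ˡ x ∷ ts → E p j → j ∈ˡ map f ts
        inside {p} {j} p∈ Epj with j ∈? map f ts
        ... | yes j∈ = j∈
        ... | no j∉ = ⊥-elim (closed (loseˡ p∈ (j , Epj , j∉)))
      ... | yes found with i , i∈ , j , Eij , j∉ ← findˡ found | Any.any? (λ y → f y Fin.≟ j) rs
      ...   | no none = saturate (exposed i∈) Eij j∉ free
        where
        free : ∀ {p} → p ∈ˡ ps → f p ≢ j
        free p∈ refl with split p∈
        ... | inj₁ p∈ts = j∉ (∈-map⁺ f p∈ts)
        ... | inj₂ p∈rs = none (loseˡ p∈rs refl)
      ...   | yes hit with y , y∈ , refl ← findˡ hit = next fuel len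
        where
        rest : List I
        rest = filter (λ p → ¬? (p Fin.≟ y)) rs
        shorter : length rest < length rs
        shorter = filter-notAll (λ p → ¬? (p Fin.≟ y)) rs (Any.map (λ y≡p ne → ne (sym y≡p)) y∈)
        split′ : ∀ {p} → p ∈ˡ ps → p ∈ˡ y ∷ ts ⊎ p ∈ˡ rest
        split′ {p} p∈ with p Fin.≟ y
        ... | yes p≡y = inj₁ (here p≡y)
        ... | no p≢y = Sum.map there (λ q → ∈-filter⁺ (λ p → ¬? (p Fin.≟ y)) q p≢y) (split p∈)
        exposed′ : ∀ {k} → k ∈ˡ x ∷ y ∷ ts → Exposed (y ∷ ts) k
        exposed′ (here refl) = exposed-x
        exposed′ (there (here refl)) = exposed-step (exposed i∈) Eij j∉ (rs⊆ y∈)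
        exposed′ (there (there k∈)) = exposed-there (exposed (there k∈))
        next : ∀ fuel → length rs ≤ fuel → Hall (x ∷ ps)
        next zero len = ⊥-elim (n≮0 (<-≤-trans shorter len))
        next (suc fuel) len = grow fuel (y ∷ ts) rest (≤-pred (<-≤-trans shorter len))
          (λ { (here refl) → rs⊆ y∈ ; (there p∈) → ts⊆ p∈ })
          (rs⊆ ∘ proj₁ ∘ ∈-filter⁻ (λ p → ¬? (p Fin.≟ y))) split′ exposed′

    hall : ∀ ps → Hall ps
    hall [] = saturated id (λ ()) (λ ())
    hall (x ∷ ps) with hall ps
    ... | deficient y ts f y∈ ts⊆ edge inj closed = deficient y ts f (there y∈) (there ∘ ts⊆) edge inj closed
    ... | saturated f edge inj = grow (length ps) [] ps ≤-refl (λ ()) id inj₂ λ where (here refl) → exposed-x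
      where open Augment ps x f edge inj

  -- A vertex cover L ⊎ R together with a matching M such that each vertex of the cover lies on an
  -- edge of M and no edge of M has both ends in the cover; hence a cover with s vertices in a
  -- component yields s matching edges there.
  record Cover (E : I → I → Set) (ps : List I) : Set₁ where
    field
      L R     : I → Set
      L?      : ∀ i → Dec (L i)
      R?      : ∀ j → Dec (R j)
      covered : ∀ {i j} → i ∈ˡ ps → E i j → L i ⊎ R j
      M       : I → I → Set
      M-edge  : ∀ {i j} → M i j → i ∈ˡ ps × E i j
      M-inj₁  : ∀ {i i′ j} → M i j → M i′ j → i ≡ i′
      M-inj₂  : ∀ {i j j′} → M i j → M i j′ → j ≡ j′
      L-M     : ∀ {i} → L i → ∃ λ j → M i j
      R-M     : ∀ {j} → R j → ∃ λ i → M i j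
      M-once  : ∀ {i j} → M i j → L i → ¬ R j

  -- Without deficiency the left side is the cover. Otherwise the neighbourhood `map f ts` covers
  -- all edges at `x ∷ ts`, both sets are deleted, and the rest is handled recursively; deleting `x`
  -- shortens the list.
  koenig : ∀ fuel {E : I → I → Set} → (∀ i j → Dec (E i j)) → ∀ ps → length ps ≤ fuel → Cover E ps
  koenig fuel {E} E? ps len with hall E? ps
  ... | saturated f edge inj = record
    { L = _∈ˡ ps ; R = λ _ → ⊥ ; L? = _∈? ps ; R? = λ _ → no λ ()
    ; covered = λ i∈ _ → inj₁ i∈
    ; M = λ i j → i ∈ˡ ps × f i ≡ j
    ; M-edge = λ { (i∈ , refl) → i∈ , edge i∈ }
    ; M-inj₁ = λ (i∈ , eq) (i′∈ , eq′) → inj i∈ i′∈ (trans eq (sym eq′))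
    ; M-inj₂ = λ (_ , eq) (_ , eq′) → trans (sym eq) eq′
    ; L-M = λ {i} i∈ → f i , i∈ , refl ; R-M = λ () ; M-once = λ _ _ () }
  koenig zero E? [] len | deficient x ts f () _ _ _ _
  koenig (suc fuel) {E} E? ps len | deficient x ts f x∈ ts⊆ edge inj closed = record
    { L = C.L ; R = λ j → j ∈ˡ map f ts ⊎ C.R j ; L? = C.L? ; R? = λ j → (j ∈? map f ts) ⊎-dec C.R? j
    ; covered = covered
    ; M = λ i j → (i ∈ˡ ts × f i ≡ j) ⊎ C.M i j
    ; M-edge = [ (λ { (i∈ , refl) → ts⊆ i∈ , edge i∈ }) , (λ m → rest⊆ (proj₁ (C.M-edge m)) , proj₁ (proj₂ (C.M-edge m))) ]′
    ; M-inj₁ = λ where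
        (inj₁ (i∈ , eq)) (inj₁ (i′∈ , eq′)) → inj i∈ i′∈ (trans eq (sym eq′))
        (inj₁ (i∈ , refl)) (inj₂ m) → ⊥-elim (proj₂ (proj₂ (C.M-edge m)) (∈-map⁺ f i∈))
        (inj₂ m) (inj₁ (i∈ , refl)) → ⊥-elim (proj₂ (proj₂ (C.M-edge m)) (∈-map⁺ f i∈))
        (inj₂ m) (inj₂ m′) → C.M-inj₁ m m′
    ; M-inj₂ = λ where
        (inj₁ (_ , eq)) (inj₁ (_ , eq′)) → trans (sym eq) eq′
        (inj₁ (i∈ , _)) (inj₂ m) → ⊥-elim (rest∌ (proj₁ (C.M-edge m)) (there i∈))
        (inj₂ m) (inj₁ (i∈ , _)) → ⊥-elim (rest∌ (proj₁ (C.M-edge m)) (there i∈))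
        (inj₂ m) (inj₂ m′) → C.M-inj₂ m m′
    ; L-M = λ l → let j , m = C.L-M l in j , inj₂ m
    ; R-M = [ (λ j∈ → let i , i∈ , eq = ∈-map⁻ f j∈ in i , inj₁ (i∈ , sym eq)) , (λ r → let i , m = C.R-M r in i , inj₂ m) ]′
    ; M-once = λ where
        -- Left cover vertices come from `rest`, hence never from `ts`.
        (inj₁ (i∈ , _)) l _ → rest∌ (proj₁ (C.M-edge (proj₂ (C.L-M l)))) (there i∈)
        (inj₂ m) _ (inj₁ j∈) → proj₂ (proj₂ (C.M-edge m)) j∈
        (inj₂ m) l (inj₂ r) → C.M-once m l r }
    where
    kept? : ∀ p → Dec (¬ p ∈ˡ x ∷ ts)
    kept? p = ¬? (p ∈? (x ∷ ts))
    rest : List I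
    rest = filter kept? ps
    rest⊆ : ∀ {p} → p ∈ˡ rest → p ∈ˡ ps
    rest⊆ p∈ = proj₁ (∈-filter⁻ kept? {xs = ps} p∈)
    rest∌ : ∀ {p} → p ∈ˡ rest → ¬ p ∈ˡ x ∷ ts
    rest∌ p∈ = proj₂ (∈-filter⁻ kept? {xs = ps} p∈)
    shorter : length rest < length ps
    shorter = filter-notAll kept? ps (loseˡ x∈ (λ x∉ → x∉ (here refl)))
    cover : Cover (λ i j → E i j × ¬ j ∈ˡ map f ts) rest
    cover = koenig fuel (λ i j → E? i j ×-dec ¬? (j ∈? map f ts)) rest (≤-pred (<-≤-trans shorter len))
    module C = Cover cover
    covered : ∀ {i j} → i ∈ˡ ps → E i j → C.L i ⊎ (j ∈ˡ map f ts ⊎ C.R j)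
    covered {i} {j} i∈ Eij with i ∈? (x ∷ ts) | j ∈? map f ts
    ... | yes i∈T | _ = inj₂ (inj₁ (closed i∈T Eij))
    ... | no _ | yes j∈ = inj₂ (inj₁ j∈)
    ... | no i∉T | no j∉ = Sum.map₂ inj₂ (C.covered (∈-filter⁺ kept? i∈ i∉T) (Eij , j∉))

-- From colourings to component labels and vertex covers

lookup-injective : ∀ {A : Set} {xs : List A} → Unique xs → ∀ {i j} → lookup xs i ≡ lookup xs j → i ≡ j
lookup-injective (x∉ ∷ u) {zero}  {zero}  eq = refl
lookup-injective (x∉ ∷ u) {zero}  {suc j} eq = ⊥-elim (All.lookup x∉ (∈-lookup j) eq)
lookup-injective (x∉ ∷ u) {suc i} {zero}  eq = ⊥-elim (All.lookup x∉ (∈-lookup i) (sym eq))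
lookup-injective (x∉ ∷ u) {suc i} {suc j} eq = cong suc (lookup-injective u eq)

count-pick : ∀ {V : Set} (D : Region V) {vs s} → Unique vs → s ≤ count D vs →
             ∃ λ (h : Fin s → V) → (∀ {a b} → h a ≡ h b → a ≡ b) × (∀ a → h a ∈ D)
count-pick D {vs} u s≤ =
  (λ a → lookup (filter (mem? D) vs) (inject≤ a s≤)) ,
  (λ eq → inject≤-injective s≤ s≤ _ _ (lookup-injective (filter⁺ (mem? D) u) eq)) ,
  (λ a → proj₂ (∈-filter⁻ (mem? D) {xs = vs} (∈-lookup (inject≤ a s≤))))

count-all : ∀ {V : Set} (D : Region V) vs → (∀ {v} → v ∈ˡ vs → v ∈ D) → length vs ≤ count D vs
count-all D vs all = ≤-reflexive (cong length (sym (filter-all (mem? D) (All.tabulate all))))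

count-++ : ∀ {V : Set} (D : Region V) us vs → count D (us ++ vs) ≡ count D us + count D vs
count-++ D us vs = trans (cong length (filter-++ (mem? D) us vs)) (length-++ (filter (mem? D) us))

-- Component labels by merging along edges

module Merge {V : Set} {R : V → V → Set} (R-sym : ∀ {u v} → R u v → R v u)
             (index : V → ℕ) (index-injective : ∀ {u v} → index u ≡ index v → u ≡ v)
             (bound : ℕ) (index<bound : ∀ v → index v < bound) where

  -- `label<` keeps the labels in a known range, which makes the later search through the green
  -- labels finite.
  record Components (es : List (V × V)) : Set where
    field
      label     : V → ℕ
      label<    : ∀ v → label v < bound
      joined    : ∀ {u v} → (u , v) ∈ˡ es → label u ≡ label v
      connected : ∀ {u v} → label u ≡ label v → Star R u v

  components : ∀ es → (∀ {u v} → (u , v) ∈ˡ es → R u v) → Components es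
  components [] _ = record
    { label = index ; label< = index<bound ; joined = λ ()
    ; connected = λ eq → subst (Star R _) (index-injective eq) ε }
  components ((a , b) ∷ es) edges = record
    { label = relabel ∘ label
    ; label< = relabel<
    ; joined = λ { (here refl) → merged ; (there e∈) → cong relabel (joined e∈) }
    ; connected = connected′ }
    where
    open Components (components es (edges ∘ there))
    relabel : ℕ → ℕ
    relabel x with x ≟ label a
    ... | yes _ = label b
    ... | no _  = x
    relabel-a : relabel (label a) ≡ label b
    relabel-a with label a ≟ label a
    ... | yes _ = refl
    ... | no ne = ⊥-elim (ne refl)
    merged : relabel (label a) ≡ relabel (label b)
    merged with label b ≟ label a
    ... | yes _ = relabel-a
    ... | no _  = relabel-a
    relabel< : ∀ v → relabel (label v) < bound
    relabel< v with label v ≟ label a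
    ... | yes _ = label< b
    ... | no _  = label< v
    a→b : Star R a b
    a→b = edges (here refl) ◅ ε
    b→a : Star R b a
    b→a = R-sym (edges (here refl)) ◅ ε
    connected′ : ∀ {u v} → relabel (label u) ≡ relabel (label v) → Star R u v
    connected′ {u} {v} eq with label u ≟ label a | label v ≟ label a
    ... | yes p | yes q = connected (trans p (sym q))
    ... | yes p | no _  = connected p ◅◅ a→b ◅◅ connected eq
    ... | no _  | yes q = connected eq ◅◅ b→a ◅◅ connected (sym q)
    ... | no _  | no _  = connected eq

_≟ᶜ_ : (c d : Colour) → Dec (c ≡ d)
red   ≟ᶜ red   = yes refl
red   ≟ᶜ blue  = no λ ()
red   ≟ᶜ green = no λ ()
blue  ≟ᶜ red   = no λ ()
blue  ≟ᶜ blue  = yes refl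
blue  ≟ᶜ green = no λ ()
green ≟ᶜ red   = no λ ()
green ≟ᶜ blue  = no λ ()
green ≟ᶜ green = yes refl

vertices : ∀ n → List (Vertex n)
vertices n = map inj₁ (allFin n) ++ map inj₂ (allFin n)

∈-vertices : ∀ {n} (v : Vertex n) → v ∈ˡ vertices n
∈-vertices (inj₁ i) = ∈-++⁺ˡ (∈-map⁺ inj₁ (∈-allFin i))
∈-vertices {n} (inj₂ j) = ∈-++⁺ʳ (map inj₁ (allFin n)) (∈-map⁺ inj₂ (∈-allFin j))

vertices-unique : ∀ n → Unique (vertices n)
vertices-unique n = ++⁺ (map⁺ inj₁-injective (allFin⁺ n)) (map⁺ inj₂-injective (allFin⁺ n)) disjoint
  where
  disjoint : ∀ {v} → v ∈ˡ map inj₁ (allFin n) × v ∈ˡ map inj₂ (allFin n) → ⊥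
  disjoint (p , q) with _ , _ , refl ← ∈-map⁻ inj₁ p | _ , _ , () ← ∈-map⁻ inj₂ q

part : ∀ {n} → (Vertex n → ℕ) → Region (Vertex n) → ℕ → Region (Vertex n)
part label S ρ .Mem v = label v ≡ ρ × v ∈ S
part label S ρ .mem? v = (label v ≟ ρ) ×-dec mem? S v

-- What the absence of a large connected matching of colour c leaves behind: S is a vertex cover
-- of the edges of colour c with at most s vertices in each component.
record Skeleton {n} (col : Colouring n) (c : Colour) (s : ℕ) : Set₁ where
  field
    label  : Vertex n → ℕ
    label< : ∀ v → label v < n + n
    S      : Region (Vertex n)
    sound  : ∀ {i j} → col i j ≡ c → label (inj₁ i) ≡ label (inj₂ j) × (inj₁ i ∈ S ⊎ inj₂ j ∈ S)
    small  : ∀ ρ → count (part label S ρ) (vertices n) ≤ s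

module Monochromatic {n} (col : Colouring n) (c : Colour) where

  adj-sym : ∀ {u v} → Adj col c u v → Adj col c v u
  adj-sym (lr eq) = rl eq
  adj-sym (rl eq) = lr eq

  index : Vertex n → ℕ
  index (inj₁ i) = toℕ i
  index (inj₂ j) = n + toℕ j

  index< : ∀ v → index v < n + n
  index< (inj₁ i) = <-≤-trans (toℕ<n i) (m≤m+n n n)
  index< (inj₂ j) = +-monoʳ-< n (toℕ<n j)

  index-injective : ∀ {u v} → index u ≡ index v → u ≡ v
  index-injective {inj₁ i} {inj₁ i′} eq = cong inj₁ (toℕ-injective eq)
  index-injective {inj₂ j} {inj₂ j′} eq = cong inj₂ (toℕ-injective (+-cancelˡ-≡ n _ _ eq))
  index-injective {inj₁ i} {inj₂ j}  eq = ⊥-elim (<⇒≱ (toℕ<n i) (≤-trans (m≤m+n n (toℕ j)) (≤-reflexive (sym eq))))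
  index-injective {inj₂ j} {inj₁ i}  eq = ⊥-elim (<⇒≱ (toℕ<n i) (≤-trans (m≤m+n n (toℕ j)) (≤-reflexive eq)))

  has-colour? : ∀ ((i , j) : Fin n × Fin n) → Dec (col i j ≡ c)
  has-colour? (i , j) = col i j ≟ᶜ c

  pairs : List (Fin n × Fin n)
  pairs = filter has-colour? (cartesianProduct (allFin n) (allFin n))

  ends : Fin n × Fin n → Vertex n × Vertex n
  ends (i , j) = inj₁ i , inj₂ j

  edges : ∀ {u v} → (u , v) ∈ˡ map ends pairs → Adj col c u v
  edges e∈ with (i , j) , p∈ , refl ← ∈-map⁻ ends e∈ =
    lr (proj₂ (∈-filter⁻ has-colour? {xs = cartesianProduct (allFin n) (allFin n)} p∈))

  open Merge {R = Adj col c} adj-sym index index-injective (n + n) index< using (Components; components)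
  open Components (components (map ends pairs) edges)

  joined-col : ∀ {i j} → col i j ≡ c → label (inj₁ i) ≡ label (inj₂ j)
  joined-col {i} {j} eq = joined (∈-map⁺ ends (∈-filter⁺ has-colour? (∈-cartesianProduct⁺ (∈-allFin i) (∈-allFin j)) eq))

  open Koenig n using (Cover; koenig)
  open Cover (koenig n (λ i j → col i j ≟ᶜ c) (allFin n) (≤-reflexive (length-tabulate id)))

  S : Region (Vertex n)
  S .Mem (inj₁ i) = L i
  S .Mem (inj₂ j) = R j
  S .mem? (inj₁ i) = L? i
  S .mem? (inj₂ j) = R? j

  Incident : Fin n → Fin n → Vertex n → Set
  Incident i j v = v ≡ inj₁ i ⊎ v ≡ inj₂ j

  matched : ∀ v → v ∈ S → ∃₂ λ i j → M i j × Incident i j v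
  matched (inj₁ i) l = let j , m = L-M l in i , j , m , inj₁ refl
  matched (inj₂ j) r = let i , m = R-M r in i , j , m , inj₂ refl

  incident-unique : ∀ {i j u v} → M i j → u ∈ S → v ∈ S → Incident i j u → Incident i j v → u ≡ v
  incident-unique m p q (inj₁ refl) (inj₁ refl) = refl
  incident-unique m p q (inj₁ refl) (inj₂ refl) = ⊥-elim (M-once m p q)
  incident-unique m p q (inj₂ refl) (inj₁ refl) = ⊥-elim (M-once m q p)
  incident-unique m p q (inj₂ refl) (inj₂ refl) = refl

  -- Each cover vertex lies on an edge of `M`, and no edge of `M` contains two of them, so `s` cover
  -- vertices give `s` distinct matching edges in the component of `y`.
  large-part : ∀ {s} y → s ≤ count (part label S (label y)) (vertices n) → ConnectedMatching col c s
  large-part {s} y s≤ with h , h-inj , h∈ ← count-pick (part label S (label y)) (vertices-unique n) s≤ =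
    y , f , g ,
    (λ {a} {b} eq → h-inj (same a b eq (M-inj₂ (subst (λ i → M i (g a)) eq (m a)) (m b)))) ,
    (λ {a} {b} eq → h-inj (same a b (M-inj₁ (subst (M (f a)) eq (m a)) (m b)) eq)) ,
    (λ a → proj₂ (M-edge (m a))) ,
    (λ a → connected (trans (sym (proj₁ (h∈ a))) (at-f (matched (h a) (proj₂ (h∈ a))))))
    where
    f g : Fin s → Fin n
    f a = proj₁ (matched (h a) (proj₂ (h∈ a)))
    g a = proj₁ (proj₂ (matched (h a) (proj₂ (h∈ a))))
    m : ∀ a → M (f a) (g a)
    m a = proj₁ (proj₂ (proj₂ (matched (h a) (proj₂ (h∈ a)))))
    on : ∀ a → Incident (f a) (g a) (h a)
    on a = proj₂ (proj₂ (proj₂ (matched (h a) (proj₂ (h∈ a)))))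
    same : ∀ a b → f a ≡ f b → g a ≡ g b → h a ≡ h b
    same a b p q = incident-unique (m b) (proj₂ (h∈ a)) (proj₂ (h∈ b))
      (subst (λ i → Incident i (g b) (h a)) p (subst (λ j → Incident (f a) j (h a)) q (on a))) (on b)
    at-f : ∀ {v} (e : ∃₂ λ i j → M i j × Incident i j v) → label v ≡ label (inj₁ (proj₁ e))
    at-f (i , j , m , inj₁ refl) = refl
    at-f (i , j , m , inj₂ refl) = sym (joined-col (proj₂ (M-edge m)))

  matching-or-skeleton : ∀ s → ConnectedMatching col c (suc s) ⊎ Skeleton col c s
  matching-or-skeleton s
    with Any.any? (λ y → suc s ≤? count (part label S (label y)) (vertices n)) (vertices n)
  ... | yes found with y , large ← Any.satisfied found = inj₁ (large-part y large)
  ... | no none = inj₂ record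
    { label = label ; label< = label< ; S = S
    ; sound = λ {i} eq → joined-col eq , covered (∈-allFin i) eq
    -- A part exceeding `s` is nonempty, so `ρ` is the label of an actual vertex, and the search
    -- over vertices would have found it.
    ; small = λ ρ → ≮⇒≥ λ large →
        let h , _ , h∈ = count-pick (part label S ρ) (vertices-unique n) large
        in none (loseˡ (∈-vertices (h zero))
                (subst (λ σ → suc s ≤ count (part label S σ) (vertices n)) (sym (proj₁ (h∈ zero))) large)) }

-- Three colours

∁ : {V : Set} → Region V → Region V
(∁ D) .Mem v = v ∉ D
(∁ D) .mem? v = ¬? (mem? D v)

_∩_ : {V : Set} → Region V → Region V → Region V
(D ∩ D′) .Mem v = v ∈ D × v ∈ D′
(D ∩ D′) .mem? v = mem? D v ×-dec mem? D′ v

preimage : {A B : Set} → (A → B) → Region B → Region A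
preimage f D .Mem v = f v ∈ D
preimage f D .mem? v = mem? D (f v)

below single : ℕ → Region ℕ
below i .Mem ℓ = ℓ < i
below i .mem? ℓ = ℓ <? i
single i .Mem ℓ = ℓ ≡ i
single i .mem? ℓ = ℓ ≟ i

Left Right : ∀ {n} → Region (Vertex n)
Left .Mem v = ∃ λ i → v ≡ inj₁ i
Left .mem? (inj₁ i) = yes (i , refl)
Left .mem? (inj₂ _) = no λ ()
Right .Mem v = ∃ λ j → v ≡ inj₂ j
Right .mem? (inj₁ _) = no λ ()
Right .mem? (inj₂ j) = yes (j , refl)

left-or-right : ∀ {n} (v : Vertex n) → v ∈ Left ⊎ v ∈ Right
left-or-right (inj₁ i) = inj₁ (i , refl)
left-or-right (inj₂ j) = inj₂ (j , refl)

left-right-disjoint : ∀ {n} {v : Vertex n} → v ∈ Left → v ∉ Right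
left-right-disjoint (_ , refl) (_ , ())

length-allFin : ∀ n → length (allFin n) ≡ n
length-allFin n = length-tabulate id

count-Left : ∀ n → n ≤ count Left (vertices n)
count-Left n = begin
  n                                                        ≡⟨ length-allFin n ⟨
  length (allFin n)                                        ≡⟨ length-map inj₁ (allFin n) ⟨
  length (map inj₁ (allFin n))                             ≤⟨ count-all Left (map inj₁ (allFin n)) (λ p → let i , _ , eq = ∈-map⁻ inj₁ p in i , eq) ⟩
  count Left (map inj₁ (allFin n))                         ≤⟨ m≤m+n _ _ ⟩
  count Left (map inj₁ (allFin n)) + count Left (map inj₂ (allFin n)) ≡⟨ count-++ Left (map inj₁ (allFin n)) (map inj₂ (allFin n)) ⟨
  count Left (vertices n)                                  ∎
  where open ≤-Reasoning

count-Right : ∀ n → n ≤ count Right (vertices n)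
count-Right n = begin
  n                                                        ≡⟨ length-allFin n ⟨
  length (allFin n)                                        ≡⟨ length-map inj₂ (allFin n) ⟨
  length (map inj₂ (allFin n))                             ≤⟨ count-all Right (map inj₂ (allFin n)) (λ p → let j , _ , eq = ∈-map⁻ inj₂ p in j , eq) ⟩
  count Right (map inj₂ (allFin n))                        ≤⟨ m≤n+m _ _ ⟩
  count Right (map inj₁ (allFin n)) + count Right (map inj₂ (allFin n)) ≡⟨ count-++ Right (map inj₁ (allFin n)) (map inj₂ (allFin n)) ⟨
  count Right (vertices n)                                 ∎
  where open ≤-Reasoning

count-both : ∀ n → n + n ≤ count (Left ∪ Right) (vertices n)
count-both n = ≤-trans (+-mono-≤ (count-Left n) (count-Right n))
                       (count-disjoint {D₁ = Left} {Right} left-right-disjoint (vertices n))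

Distinct : Fin 3 → Fin 3 → Fin 3 → Set
Distinct i j k = i ≢ j × j ≢ k × i ≢ k

exhaust? : Dec (∀ i j k → Distinct i j k → ∀ h → h ≡ i ⊎ h ≡ j ⊎ h ≡ k)
exhaust? = Fin.all? λ i → Fin.all? λ j → Fin.all? λ k →
  (¬? (i Fin.≟ j) ×-dec ¬? (j Fin.≟ k) ×-dec ¬? (i Fin.≟ k)) →-dec
  Fin.all? λ h → (h Fin.≟ i) ⊎-dec (h Fin.≟ j) ⊎-dec (h Fin.≟ k)

exhaust : ∀ i j k → Distinct i j k → ∀ h → h ≡ i ⊎ h ≡ j ⊎ h ≡ k
exhaust = from-yes exhaust?

module Upper {κ λ′ μ : ℕ} (κ+λ≤μ : κ + λ′ ≤ μ) (col : Colouring (suc (κ + λ′ + μ)))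
             (Red : Skeleton col red κ) (Blue : Skeleton col blue λ′) (Green : Skeleton col green μ) where

  t N : ℕ
  t = κ + λ′
  N = suc (t + μ)

  module Rd = Skeleton Red
  module Bl = Skeleton Blue
  module Gr = Skeleton Green

  vs : List (Vertex N)
  vs = vertices N

  label : Bool → Vertex N → ℕ
  label true  = Rd.label
  label false = Bl.label

  S : Bool → Region (Vertex N)
  S true  = Rd.S
  S false = Bl.S

  open TwoColours label S

  shadow≤t : ∀ y → count (shadow y) vs ≤ t
  shadow≤t y = ≤-trans
    (count-cover {D = shadow y} {part Rd.label Rd.S (Rd.label y)} {part Bl.label Bl.S (Bl.label y)}
      (λ { (true , p) → inj₁ p ; (false , p) → inj₂ p }) vs)
    (+-mono-≤ (Rd.small (Rd.label y)) (Bl.small (Bl.label y)))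

  open Bounded vs ∈-vertices t shadow≤t

  g : Vertex N → ℕ
  g = Gr.label

  non-green : ∀ {u v} → u ∈ Left → v ∈ Right → ¬ (g u ≡ g v × (u ∈ Gr.S ⊎ v ∈ Gr.S)) → Edge u v
  non-green (i , refl) (j , refl) no-green with col i j in eq
  ... | red   = true , Rd.sound eq
  ... | blue  = false , Bl.sound eq
  ... | green = ⊥-elim (no-green (Gr.sound eq))

  cover-count : ∀ {D D₁ D₂ : Region (Vertex N)} {s} → s ≤ ∣ D ∣ → (∀ {v} → v ∈ D → v ∈ D₁ ⊎ v ∈ D₂) → s ≤ ∣ D₁ ∣ + ∣ D₂ ∣
  cover-count {D} {D₁} {D₂} s≤ cov = ≤-trans s≤ (count-cover {D = D} {D₁} {D₂} cov vs)

  big-from-N : ∀ {c d} → N ≤ c + d → d ≤ t → t < c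
  big-from-N {c} {d} N≤ d≤t = +-cancelʳ-≤ t (suc t) c
    (≤-trans (s≤s (+-monoʳ-≤ t κ+λ≤μ)) (≤-trans N≤ (+-monoʳ-≤ c d≤t)))

  big-from-N-μ : ∀ {c d} → N ≤ c + d → d ≤ μ → t < c
  big-from-N-μ {c} {d} N≤ d≤μ = +-cancelʳ-≤ μ (suc t) c (≤-trans N≤ (+-monoʳ-≤ c d≤μ))

  -- Here `μ ≥ t` enters: discarding at most `μ` vertices from the two sides together leaves the
  -- more than `3 * t` that `no-zigzag` asks for.
  3t+μ<2N : 3 * t + μ < N + N
  3t+μ<2N = begin-strict
    3 * t + μ           ≡⟨ solve 2 (λ a b → con 3 :* a :+ b := (a :+ b) :+ (a :+ a)) refl t μ ⟩
    (t + μ) + (t + t)   ≤⟨ +-monoʳ-≤ (t + μ) (+-monoʳ-≤ t κ+λ≤μ) ⟩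
    (t + μ) + (t + μ)   <⟨ +-mono-< (n<1+n (t + μ)) (n<1+n (t + μ)) ⟩
    N + N               ∎
    where
    open ≤-Reasoning
    open +-*-Solver

  big-core : ∀ {c d} → N + N ≤ c + d → d ≤ μ → 3 * t < c
  big-core {c} {d} 2N≤ d≤μ = +-cancelʳ-< μ (3 * t) c (<-≤-trans 3t+μ<2N (≤-trans 2N≤ (+-monoʳ-≤ c d≤μ)))

  big-middle : ∀ {c d e} → N + N ≤ c + (d + e) → d ≤ μ → e ≤ t + t → t < c
  big-middle {c} {d} {e} 2N≤ d≤μ e≤2t = +-cancelʳ-< (μ + (t + t)) t c (begin-strict
    t + (μ + (t + t))   ≡⟨ solve 2 (λ a b → a :+ (b :+ (a :+ a)) := con 3 :* a :+ b) refl t μ ⟩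
    3 * t + μ           <⟨ 3t+μ<2N ⟩
    N + N               ≤⟨ 2N≤ ⟩
    c + (d + e)         ≤⟨ +-monoʳ-≤ c (+-mono-≤ d≤μ e≤2t) ⟩
    c + (μ + (t + t))   ∎)
    where
    open ≤-Reasoning
    open +-*-Solver

  big-total : 4 * t < N + N
  big-total = ≤-<-trans (≤-trans (≤-reflexive (solve 1 (λ a → con 4 :* a := con 3 :* a :+ a) refl t))
                                 (+-monoʳ-≤ (3 * t) κ+λ≤μ)) 3t+μ<2N
    where open +-*-Solver

  -- Grouping the green components

  X Y : Region ℕ → Region (Vertex N)
  X φ = Left ∩ preimage g φ
  Y φ = Right ∩ preimage g φ

  Small : Region ℕ → Set
  Small φ = ∣ X φ ∣ ≤ t × ∣ Y φ ∣ ≤ t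

  separated : ∀ φ ψ → (∀ {ℓ} → ℓ ∈ φ → ℓ ∉ ψ) → Complete (X φ) (Y ψ)
  separated φ ψ disjoint (u∈ , p) (v∈ , q) = non-green u∈ v∈ λ (eq , _) → disjoint p (subst (_∈ ψ) (sym eq) q)

  not-both-big : ∀ φ ψ → (∀ {ℓ} → ℓ ∈ φ → ℓ ∉ ψ) → t < ∣ X φ ∣ → t < ∣ Y ψ ∣ → ⊥
  not-both-big φ ψ disjoint bigX bigY = no-large-biclique {X φ} {Y ψ} (separated φ ψ disjoint) bigX bigY
    (<-≤-trans (≤-<-trans (≤-reflexive (cong (t +_) (+-identityʳ t))) (+-mono-< bigX bigY))
      (count-disjoint {D₁ = X φ} {Y ψ} (λ (p , _) (q , _) → left-right-disjoint p q) vs))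

  split-Left : ∀ φ → N ≤ ∣ X φ ∣ + ∣ X (∁ φ) ∣
  split-Left φ = cover-count {Left} {X φ} {X (∁ φ)} (count-Left N) split
    where
    split : ∀ {v} → v ∈ Left → v ∈ X φ ⊎ v ∈ X (∁ φ)
    split {v} v∈ with mem? φ (g v)
    ... | yes p = inj₁ (v∈ , p)
    ... | no ¬p = inj₂ (v∈ , ¬p)

  split-Right : ∀ φ → N ≤ ∣ Y φ ∣ + ∣ Y (∁ φ) ∣
  split-Right φ = cover-count {Right} {Y φ} {Y (∁ φ)} (count-Right N) split
    where
    split : ∀ {v} → v ∈ Right → v ∈ Y φ ⊎ v ∈ Y (∁ φ)
    split {v} v∈ with mem? φ (g v)
    ... | yes p = inj₁ (v∈ , p)
    ... | no ¬p = inj₂ (v∈ , ¬p)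

  -- Since N > 2t and X φ, Y (∁ φ) span no green edge, the green components cannot be split evenly.
  dichotomy : ∀ φ → Small φ ⊎ Small (∁ φ)
  dichotomy φ with ∣ X φ ∣ ≤? t
  ... | yes X≤t = inj₁ (X≤t , ≮⇒≥ λ bigY → not-both-big (∁ φ) φ (λ p q → p q)
                    (big-from-N (≤-trans (split-Left φ) (≤-reflexive (+-comm ∣ X φ ∣ _))) X≤t) bigY)
  ... | no X≰t = inj₂ (≮⇒≥ (λ bigX → not-both-big (∁ φ) φ (λ p q → p q) bigX (big-from-N (split-Right φ) Ȳ≤t)) , Ȳ≤t)
    where
    Ȳ≤t : ∣ Y (∁ φ) ∣ ≤ t
    Ȳ≤t = ≮⇒≥ λ bigY → not-both-big φ (∁ φ) (λ p q → q p) (≰⇒> X≰t) bigY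

  -- Lower `M` while the labels from `M` upwards stay small. At 0 they include all `N > t` left
  -- vertices, so by `dichotomy` the small side must switch before.
  threshold : ∀ M → Small (∁ (below M)) → ∃ λ i → Small (below i) × Small (∁ (below (suc i)))
  threshold zero (small , _) = ⊥-elim (<⇒≱ (≤-<-trans (m≤m+n t μ) (n<1+n _))
    (≤-trans (≤-trans (count-Left N) (count-mono {D = Left} {X (∁ (below 0))} (λ p → p , λ ()) vs)) small))
  threshold (suc M) small with dichotomy (below M)
  ... | inj₁ small-below = M , small-below , small
  ... | inj₂ small-above = threshold M small-above

  some-member : ∀ {D D′ : Region (Vertex N)} → t < ∣ D ∪ D′ ∣ → ∣ D′ ∣ ≤ t → ∃ λ v → v ∈ D
  some-member {D} {D′} big small with count-escape {D = D ∪ D′} {D′} vs (≤-<-trans small big)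
  ... | v , inj₁ v∈ , _  = v , v∈
  ... | v , inj₂ v∈ , v∉ = ⊥-elim (v∉ v∈)

  -- V₁ ∪ V₂ is the vertex cover of the large green component γ.
  module LargeComponent (γ : ℕ) (rest-small : Small (∁ (single γ))) where

    Γ : Region ℕ
    Γ = single γ

    V₁ V₂ U₁ U₂ A₁ A₂ : Region (Vertex N)
    V₁ = X Γ ∩ Gr.S
    V₂ = Y Γ ∩ Gr.S
    U₁ = X Γ ∩ ∁ Gr.S
    U₂ = Y Γ ∩ ∁ Gr.S
    A₁ = X (∁ Γ)
    A₂ = Y (∁ Γ)

    V≤μ : ∣ V₁ ∪ V₂ ∣ ≤ μ
    V≤μ = ≤-trans (count-mono {D = V₁ ∪ V₂} {part g Gr.S γ}
                    [ (λ ((_ , p) , s) → p , s) , (λ ((_ , p) , s) → p , s) ]′ vs) (Gr.small γ)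

    V₁≤μ : ∣ V₁ ∣ ≤ μ
    V₁≤μ = ≤-trans (count-mono {D = V₁} {V₁ ∪ V₂} inj₁ vs) V≤μ

    V₂≤μ : ∣ V₂ ∣ ≤ μ
    V₂≤μ = ≤-trans (count-mono {D = V₂} {V₁ ∪ V₂} inj₂ vs) V≤μ

    split₁ : ∀ {v} → v ∈ Left → v ∈ U₁ ⊎ v ∈ V₁ ⊎ v ∈ A₁
    split₁ {v} v∈ with mem? Γ (g v) | mem? Gr.S v
    ... | no ¬p | _     = inj₂ (inj₂ (v∈ , ¬p))
    ... | yes p | yes s = inj₂ (inj₁ ((v∈ , p) , s))
    ... | yes p | no ¬s = inj₁ ((v∈ , p) , ¬s)

    split₂ : ∀ {v} → v ∈ Right → v ∈ U₂ ⊎ v ∈ V₂ ⊎ v ∈ A₂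
    split₂ {v} v∈ with mem? Γ (g v) | mem? Gr.S v
    ... | no ¬p | _     = inj₂ (inj₂ (v∈ , ¬p))
    ... | yes p | yes s = inj₂ (inj₁ ((v∈ , p) , s))
    ... | yes p | no ¬s = inj₁ ((v∈ , p) , ¬s)

    U₁∪A₁ : t < ∣ U₁ ∪ A₁ ∣
    U₁∪A₁ = big-from-N-μ (cover-count {Left} {U₁ ∪ A₁} {V₁} (count-Left N) ([ inj₁ ∘ inj₁ , [ inj₂ , inj₁ ∘ inj₂ ]′ ]′ ∘ split₁)) V₁≤μ

    U₂∪A₂ : t < ∣ U₂ ∪ A₂ ∣
    U₂∪A₂ = big-from-N-μ (cover-count {Right} {U₂ ∪ A₂} {V₂} (count-Right N) ([ inj₁ ∘ inj₁ , [ inj₂ , inj₁ ∘ inj₂ ]′ ]′ ∘ split₂)) V₂≤μ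

    zigzag : Zigzag V₁ A₂ U₁ U₂ A₁ V₂
    zigzag = record
      { v₁a₂ = λ (p , _) q → separated Γ (∁ Γ) (λ a b → b a) p q
      ; u₁a₂ = λ (p , _) q → separated Γ (∁ Γ) (λ a b → b a) p q
      -- Both ends are in the component `γ`, but outside its vertex cover, so the edge is not green.
      ; u₁u₂ = λ ((p , _) , ¬s) ((q , _) , ¬s′) → non-green p q λ (_ , s) → [ ¬s , ¬s′ ]′ s
      ; a₁u₂ = λ p (q , _) → separated (∁ Γ) Γ (λ a b → a b) p q
      ; a₁v₂ = λ p (q , _) → separated (∁ Γ) Γ (λ a b → a b) p q
      ; u₁∪v₁ = big-from-N (cover-count {Left} {U₁ ∪ V₁} {A₁} (count-Left N) ([ inj₁ ∘ inj₁ , [ inj₁ ∘ inj₂ , inj₂ ]′ ]′ ∘ split₁)) (proj₁ rest-small)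
      ; u₁∪a₁ = U₁∪A₁
      -- What is discarded is the green cover, at most `μ`, and the two remainders, at most `t`
      -- each.
      ; u₁∪u₂ = big-middle (≤-trans (cover-count {Left ∪ Right} {U₁ ∪ U₂} {(V₁ ∪ V₂) ∪ (A₁ ∪ A₂)} (count-both N)
                  [ [ inj₁ ∘ inj₁ , [ inj₂ ∘ inj₁ ∘ inj₁ , inj₂ ∘ inj₂ ∘ inj₁ ]′ ]′ ∘ split₁
                  , [ inj₁ ∘ inj₂ , [ inj₂ ∘ inj₁ ∘ inj₂ , inj₂ ∘ inj₂ ∘ inj₂ ]′ ]′ ∘ split₂ ]′)
                  (+-monoʳ-≤ ∣ U₁ ∪ U₂ ∣ (count-cover {D = (V₁ ∪ V₂) ∪ (A₁ ∪ A₂)} {V₁ ∪ V₂} {A₁ ∪ A₂} id vs)))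
                  V≤μ (≤-trans (count-cover {D = A₁ ∪ A₂} {A₁} {A₂} id vs) (+-mono-≤ (proj₁ rest-small) (proj₂ rest-small)))
      ; u₂∪a₂ = U₂∪A₂
      ; u₂∪v₂ = big-from-N (cover-count {Right} {U₂ ∪ V₂} {A₂} (count-Right N) ([ inj₁ ∘ inj₁ , [ inj₁ ∘ inj₂ , inj₂ ]′ ]′ ∘ split₂)) (proj₂ rest-small)
      ; u₁ = some-member {U₁} {A₁} U₁∪A₁ (proj₁ rest-small)
      ; u₂ = some-member {U₂} {A₂} U₂∪A₂ (proj₂ rest-small) }

    impossible : ⊥
    impossible = no-zigzag zigzag (big-core (cover-count {Left ∪ Right} {(U₁ ∪ A₁) ∪ (U₂ ∪ A₂)} {V₁ ∪ V₂} (count-both N)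
      [ [ inj₁ ∘ inj₁ ∘ inj₁ , [ inj₂ ∘ inj₁ , inj₁ ∘ inj₁ ∘ inj₂ ]′ ]′ ∘ split₁
      , [ inj₁ ∘ inj₂ ∘ inj₁ , [ inj₂ ∘ inj₂ , inj₁ ∘ inj₂ ∘ inj₂ ]′ ]′ ∘ split₂ ]′) V≤μ)

  module ThreeBlocks (class : ℕ → Fin 3) where

    block′ : Fin 3 → Region ℕ
    block′ a .Mem ℓ = class ℓ ≡ a
    block′ a .mem? ℓ = class ℓ Fin.≟ a

    P Q : Fin 3 → Region (Vertex N)
    P a = X (block′ a)
    Q a = Y (block′ a)

    module _ (all-small : ∀ a → Small (block′ a)) where

      complete : ∀ {a b} → a ≢ b → Complete (P a) (Q b)
      complete {a} {b} a≢b = separated (block′ a) (block′ b) λ p q → a≢b (trans (sym p) q)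

      module _ {i j k} (d : Distinct i j k) where

        split-P : ∀ {v} → v ∈ Left → v ∈ P i ⊎ v ∈ P j ⊎ v ∈ P k
        split-P {v} v∈ = Sum.map (v∈ ,_) (Sum.map (v∈ ,_) (v∈ ,_)) (exhaust i j k d (class (g v)))

        split-Q : ∀ {v} → v ∈ Right → v ∈ Q i ⊎ v ∈ Q j ⊎ v ∈ Q k
        split-Q {v} v∈ = Sum.map (v∈ ,_) (Sum.map (v∈ ,_) (v∈ ,_)) (exhaust i j k d (class (g v)))

        P∪P : t < ∣ P i ∪ P j ∣
        P∪P = big-from-N (cover-count {Left} {P i ∪ P j} {P k} (count-Left N)
          ([ inj₁ ∘ inj₁ , [ inj₁ ∘ inj₂ , inj₂ ]′ ]′ ∘ split-P)) (proj₁ (all-small k))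

        Q∪Q : t < ∣ Q i ∪ Q j ∣
        Q∪Q = big-from-N (cover-count {Right} {Q i ∪ Q j} {Q k} (count-Right N)
          ([ inj₁ ∘ inj₁ , [ inj₁ ∘ inj₂ , inj₂ ]′ ]′ ∘ split-Q)) (proj₂ (all-small k))

      P-member : ∀ {i j k} → Distinct i j k → ∃ λ v → v ∈ P i
      P-member {i} {j} d = some-member {P i} {P j} (P∪P d) (proj₁ (all-small j))

      Q-member : ∀ {i j k} → Distinct i j k → ∃ λ v → v ∈ Q i
      Q-member {i} {j} d = some-member {Q i} {Q j} (Q∪Q d) (proj₂ (all-small j))

      -- Joining `P a` to `Q b` for `a ≢ b` gives K_{3,3} minus a perfect matching, which is a
      -- hexagon; leaving out `P i` - `Q j` makes it a path.
      zigzag : ∀ {i j k} → Distinct i j k → t < ∣ P j ∪ Q i ∣ → Zigzag (P i) (Q k) (P j) (Q i) (P k) (Q j)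
      zigzag (i≢j , j≢k , i≢k) big = record
        { v₁a₂ = complete i≢k ; u₁a₂ = complete j≢k ; u₁u₂ = complete (i≢j ∘ sym)
        ; a₁u₂ = complete (i≢k ∘ sym) ; a₁v₂ = complete (j≢k ∘ sym)
        ; u₁∪v₁ = P∪P (i≢j ∘ sym , i≢k , j≢k)
        ; u₁∪a₁ = P∪P (j≢k , i≢k ∘ sym , i≢j ∘ sym)
        ; u₁∪u₂ = big
        ; u₂∪a₂ = Q∪Q (i≢k , j≢k ∘ sym , i≢j)
        ; u₂∪v₂ = Q∪Q (i≢j , j≢k , i≢k)
        ; u₁ = P-member (j≢k , i≢k ∘ sym , i≢j ∘ sym)
        ; u₂ = Q-member (i≢j , j≢k , i≢k) }

      -- If `P i ∪ Q j` were small, it could serve as the two ends of a path, in the role the green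
      -- cover has for a large component, and `no-zigzag` would apply.
      P∪Q : ∀ {i j k} → Distinct i j k → t < ∣ P i ∪ Q j ∣
      P∪Q {i} {j} {k} d = ≰⇒> λ small → no-zigzag
        (zigzag d (big-middle
          (≤-trans (cover-count {Left ∪ Right} {P j ∪ Q i} {(P i ∪ Q j) ∪ (P k ∪ Q k)} (count-both N)
            [ [ inj₂ ∘ inj₁ ∘ inj₁ , [ inj₁ ∘ inj₁ , inj₂ ∘ inj₂ ∘ inj₁ ]′ ]′ ∘ split-P d
            , [ inj₁ ∘ inj₂ , [ inj₂ ∘ inj₁ ∘ inj₂ , inj₂ ∘ inj₂ ∘ inj₂ ]′ ]′ ∘ split-Q d ]′)
            (+-monoʳ-≤ ∣ P j ∪ Q i ∣ (count-cover {D = (P i ∪ Q j) ∪ (P k ∪ Q k)} {P i ∪ Q j} {P k ∪ Q k} id vs)))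
          (≤-trans small κ+λ≤μ)
          (≤-trans (count-cover {D = P k ∪ Q k} {P k} {Q k} id vs) (+-mono-≤ (proj₁ (all-small k)) (proj₂ (all-small k))))))
        (big-core (cover-count {Left ∪ Right} {(P j ∪ P k) ∪ (Q i ∪ Q k)} {P i ∪ Q j} (count-both N)
            [ [ inj₂ ∘ inj₁ , [ inj₁ ∘ inj₁ ∘ inj₁ , inj₁ ∘ inj₁ ∘ inj₂ ]′ ]′ ∘ split-P d
            , [ inj₁ ∘ inj₂ ∘ inj₁ , [ inj₂ ∘ inj₂ , inj₁ ∘ inj₂ ∘ inj₂ ]′ ]′ ∘ split-Q d ]′)
          (≤-trans small κ+λ≤μ))

      hexagon : ∀ {i j k} → Distinct i j k → Hexagon (P i) (Q k) (P j) (Q i) (P k) (Q j)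
      hexagon {i} {j} {k} d@(i≢j , j≢k , i≢k) = record
        { zigzag = zigzag d (P∪Q (i≢j ∘ sym , i≢k , j≢k))
        ; v₁v₂ = complete i≢j
        ; a₁∪v₁ = P∪P (i≢k ∘ sym , i≢j , j≢k ∘ sym)
        ; a₂∪v₂ = Q∪Q (j≢k ∘ sym , i≢j ∘ sym , i≢k ∘ sym)
        ; a₁∪u₂ = P∪Q (i≢k ∘ sym , i≢j , j≢k ∘ sym)
        ; a₂∪u₁ = ∪-comm-big (P j) (Q k) (P∪Q (j≢k , i≢k ∘ sym , i≢j ∘ sym))
        ; a₁ = P-member (i≢k ∘ sym , i≢j , j≢k ∘ sym)
        ; a₂ = Q-member (i≢k ∘ sym , i≢j , j≢k ∘ sym) }

      impossible : ⊥
      impossible = no-hexagon (hexagon d) (<-≤-trans big-total (≤-trans (count-both N)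
        (count-mono {D = Left ∪ Right} {(P one ∪ P two ∪ P zero) ∪ (Q zero ∪ Q two ∪ Q one)}
          [ [ inj₁ ∘ inj₂ ∘ inj₂ , [ inj₁ ∘ inj₁ , inj₁ ∘ inj₂ ∘ inj₁ ]′ ]′ ∘ split-P d
          , [ inj₂ ∘ inj₁ , [ inj₂ ∘ inj₂ ∘ inj₂ , inj₂ ∘ inj₂ ∘ inj₁ ]′ ]′ ∘ split-Q d ]′ vs)))
        where
        one two : Fin 3
        one = suc zero
        two = suc (suc zero)
        d : Distinct zero one two
        d = (λ ()) , (λ ()) , (λ ())

  small-⊆ : ∀ {φ ψ} → (∀ {ℓ} → ℓ ∈ φ → ℓ ∈ ψ) → Small ψ → Small φ
  small-⊆ {φ} {ψ} sub (x , y) =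
    ≤-trans (count-mono {D = X φ} {X ψ} (λ (p , q) → p , sub q) vs) x ,
    ≤-trans (count-mono {D = Y φ} {Y ψ} (λ (p , q) → p , sub q) vs) y

  above-all-small : Small (∁ (below (N + N)))
  above-all-small = ≤-trans (empty X proj₂) z≤n , ≤-trans (empty Y proj₂) z≤n
    where
    empty : (Z : Region ℕ → Region (Vertex N)) →
            (∀ {v} → v ∈ Z (∁ (below (N + N))) → g v ∉ below (N + N)) → ∣ Z (∁ (below (N + N))) ∣ ≤ 0
    empty Z above = ≤-trans (count-mono {D = Z (∁ (below (N + N)))} {shadows []}
                              (λ {v} p → ⊥-elim (above p (Gr.label< v))) vs) (shadows-size [])

  contradictory : ⊥
  contradictory with i , small-below , small-above ← threshold (N + N) above-all-small with dichotomy (single i)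
  ... | inj₂ rest-small = LargeComponent.impossible i rest-small
  -- The three blocks are the green labels below, equal to and above `i`.
  ... | inj₁ small-i = ThreeBlocks.impossible class all-small
    where
    class : ℕ → Fin 3
    class ℓ with <-cmp ℓ i
    ... | tri< _ _ _ = zero
    ... | tri≈ _ _ _ = suc zero
    ... | tri> _ _ _ = suc (suc zero)
    class-below : ∀ {ℓ} → class ℓ ≡ zero → ℓ < i
    class-below {ℓ} eq with <-cmp ℓ i
    ... | tri< lt _ _ = lt
    class-at : ∀ {ℓ} → class ℓ ≡ suc zero → ℓ ≡ i
    class-at {ℓ} eq with <-cmp ℓ i
    ... | tri≈ _ e _ = e
    class-above : ∀ {ℓ} → class ℓ ≡ suc (suc zero) → ¬ ℓ < suc i
    class-above {ℓ} eq with <-cmp ℓ i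
    ... | tri> _ _ gt = ≤⇒≯ gt
    open ThreeBlocks class using (block′)
    all-small : ∀ a → Small (block′ a)
    all-small zero = small-⊆ {block′ zero} {below i} class-below small-below
    all-small (suc zero) = small-⊆ {block′ (suc zero)} {single i} class-at small-i
    all-small (suc (suc zero)) = small-⊆ {block′ (suc (suc zero))} {∁ (below (suc i))} class-above small-above

arrows : ∀ κ λ′ μ → κ + λ′ ≤ μ → Arrows (suc (κ + λ′ + μ)) (suc κ) (suc λ′) (suc μ)
arrows κ λ′ μ κ+λ≤μ col with Monochromatic.matching-or-skeleton col red κ
... | inj₁ m = inj₁ m
... | inj₂ Red with Monochromatic.matching-or-skeleton col blue λ′
...   | inj₁ m = inj₂ (inj₁ m)
...   | inj₂ Blue with Monochromatic.matching-or-skeleton col green μ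
...     | inj₁ m = inj₂ (inj₂ m)
...     | inj₂ Green = ⊥-elim (Upper.contradictory κ+λ≤μ col Red Blue Green)

-- The lower bound

interval-pigeonhole : ∀ {n s} a (f : Fin (suc s) → Fin n) → Injective _≡_ _≡_ f →
                      (∀ x → a ≤ toℕ (f x)) → (∀ x → toℕ (f x) < a + s) → ⊥
interval-pigeonhole {s = s} a f f-inj lower upper =
  let x , y , x<y , eq = Fin.pigeonhole (n<1+n s) shifted
  in <⇒≢ x<y (cong toℕ (f-inj (toℕ-injective (unshift x y eq))))
  where
  offset< : ∀ x → toℕ (f x) ∸ a < s
  offset< x = +-cancelˡ-< a (toℕ (f x) ∸ a) s (subst (_< a + s) (sym (m+[n∸m]≡n (lower x))) (upper x))
  shifted : Fin (suc s) → Fin s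
  shifted x = fromℕ< (offset< x)
  unshift : ∀ x y → shifted x ≡ shifted y → toℕ (f x) ≡ toℕ (f y)
  unshift x y eq = begin
    toℕ (f x)             ≡⟨ m+[n∸m]≡n (lower x) ⟨
    a + (toℕ (f x) ∸ a)   ≡⟨ cong (a +_) (Fin.fromℕ<-injective (toℕ (f x) ∸ a) (toℕ (f y) ∸ a) (offset< x) (offset< y) eq) ⟩
    a + (toℕ (f y) ∸ a)   ≡⟨ m+[n∸m]≡n (lower y) ⟩
    toℕ (f y)             ∎
    where open ≡-Reasoning

-- For smaller `n` the stripes are merely truncated, so one pattern refutes every order below `N`.
module Lower (κ λ′ μ n : ℕ) (n≤ : n ≤ κ + λ′ + μ) where

  stripe : ℕ → Colour
  stripe x with x <? κ | x <? κ + λ′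
  ... | yes _ | _     = red
  ... | no _  | yes _ = blue
  ... | no _  | no _  = green

  stripe-red : ∀ x → stripe x ≡ red → x < κ
  stripe-red x eq with x <? κ | x <? κ + λ′
  ... | yes p | _ = p
  stripe-red x () | no _ | yes _
  stripe-red x () | no _ | no _

  stripe-blue : ∀ x → stripe x ≡ blue → κ ≤ x × x < κ + λ′
  stripe-blue x eq with x <? κ | x <? κ + λ′
  ... | no p | yes q = ≮⇒≥ p , q
  stripe-blue x () | yes _ | _
  stripe-blue x () | no _ | no _

  stripe-green : ∀ x → stripe x ≡ green → κ + λ′ ≤ x
  stripe-green x eq with x <? κ | x <? κ + λ′
  ... | no _ | no q = ≮⇒≥ q
  stripe-green x () | yes _ | _
  stripe-green x () | no _ | yes _

  not-arrows : ¬ Arrows n (suc κ) (suc λ′) (suc μ)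
  not-arrows arrow with arrow (λ i _ → stripe (toℕ i))
  ... | inj₁ (_ , f , _ , f-inj , _ , col , _) =
    interval-pigeonhole 0 f f-inj (λ _ → z≤n) (λ x → stripe-red _ (col x))
  ... | inj₂ (inj₁ (_ , f , _ , f-inj , _ , col , _)) =
    interval-pigeonhole κ f f-inj (λ x → proj₁ (stripe-blue _ (col x))) (λ x → proj₂ (stripe-blue _ (col x)))
  ... | inj₂ (inj₂ (_ , f , _ , f-inj , _ , col , _)) =
    interval-pigeonhole (κ + λ′) f f-inj (λ x → stripe-green _ (col x)) (λ x → <-≤-trans (toℕ<n (f x)) n≤)

-- The exact value

order : ∀ κ λ′ μ → suc κ + suc λ′ + suc μ ∸ 2 ≡ suc (κ + λ′ + μ)
order κ λ′ μ = begin
  κ + suc λ′ + suc μ ∸ 1     ≡⟨ cong (λ x → x + suc μ ∸ 1) (+-suc κ λ′) ⟩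
  κ + λ′ + suc μ             ≡⟨ +-suc (κ + λ′) μ ⟩
  suc (κ + λ′ + μ)           ∎
  where open ≡-Reasoning

theorem4p3 : (k l m : ℕ) → 2 ≤ k → k < l → k + l ∸ 1 ≤ m →
    RIs k l m (k + l + m ∸ 2)
-- Rewritten as `suc (κ + λ′) ≤ m`, the bound shows that `m` is a successor and yields `κ + λ′ ≤ μ`.
theorem4p3 (suc κ) (suc λ′) m _ _ k+l≤m with m | subst (_≤ m) (+-suc κ λ′) k+l≤m
... | suc μ | s≤s κ+λ≤μ = subst (RIs (suc κ) (suc λ′) (suc μ)) (sym (order κ λ′ μ))
  (arrows κ λ′ μ κ+λ≤μ , λ n n<N → Lower.not-arrows κ λ′ μ n (≤-pred n<N))
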